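{- For any finite graph $G=(V,E)$, and any fixed ordering of the edge set $E$, \[H^*(F^{\mathrm{CS}})\cong H^*(F^{\mathrm{CS}}|_{\mathrm{NBC}}),\] where $F^{\mathrm{CS}}=F^{\mathrm{CS}}_G:2^E\to\mathbb{C}[S_n]\text{ - }\mathbf{gmod}$, $n=|V|$, is the chromatic symmetric functor.
   Context: A finite graph $G=(V,E)$ consists of a finite set $V$ and a set $E$ of 2-element subsets of $V$. A cycle is (the edge set of) a closed sequence $x_1,\dots,x_k,x_1$ with $k\ge 3$, $x_1,\dots,x_k$ distinct vertices and each $\{x_i,x_{i+1}\}$ an edge (indices mod $k$). Fix an ordering $e_1,\dots,e_m$ of $E$. A broken circuit is a set $C\setminus\{e\}$ where $C\subseteq E$ is a cycle and $e$ is the edge of $C$ with the largest label. $\mathrm{NBC}$ is the set of all $S\subseteq E$ that contain no broken circuit; it is a lower order ideal of the Boolean lattice $2^E$ (subsets of $E$ ordered by inclusion). $\mathbb{C}[S_n]\text{ - }\mathbf{gmod}$ is the category of graded $\mathbb{C}[S_n]$-modules and degree-preserving homomorphisms. $S^\lambda$ is the irreducible $\mathbb{C}[S_n]$-module indexed by the partition $\lambda\vdash n$. For $n\in\mathbb{N}$, $n\ge1$, let $\mathcal{L}_n$ be the graded $\mathbb{C}[S_n]$-module \[\mathcal{L}_n=\bigwedge\nolimits^{*}S^{(n-1,1)}=\bigoplus_{k=0}^{n-1}\bigwedge\nolimits^{k}S^{(n-1,1)}=\bigoplus_{k=0}^{n-1}S^{(n-k,1^k)}\{k\},\] where $\{k\}$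 shifts the grading up by $k$, so the $k$-th exterior power sits in degree $k$ (for $n=1$ this is the trivial module in degree $0$). For $T\subseteq E$, let $B_1,\dots,B_r$ be the vertex sets of the connected components of the spanning subgraph $(V,T)$, $b_i=|B_i|$, and let \[\mathcal{M}_T=\mathrm{Ind}_{S_{B_1}\times\cdots\times S_{B_r}}^{S_{V}}(\mathcal{L}_{b_1}\otimes\cdots\otimes\mathcal{L}_{b_r}),\qquad S_V\cong S_n,\] which depends only on the partition of $V$ into components of $T$. The chromatic symmetric functor $F^{\mathrm{CS}}$ is a functor on the poset $2^E$ (viewed as a category) with $F^{\mathrm{CS}}(T)=\mathcal{M}_T$ and $F^{\mathrm{CS}}(T\lessdot T\cup\{e\})=d_{T\lessdot T\cup\{e\}}:\mathcal{M}_T\to\mathcal{M}_{T\cup\{e\}}$ on cover relations, where $d_{T\lessdot T\cup\{e\}}$ is the identity map whenever adding $e$ to $T$ completes a cycle. When $e$ joins two distinct components, $d_{T\lessdot T\cup\{e\}}$ is a prescribed morphism of graded $\mathbb{C}[S_n]$-modules (the one of Sazdanović and Yip); the statement is to be read for any such choice making $F^{\mathrm{CS}}$ a functor. Let $c(T\lessdot T\cup\{e_i\})=(-1)^{\#\{e_j\in T\,:\,j<i\}}$. For a lower order ideal $Q$ of $2^E$ (in particular $Q=2^E$ or $Q=\mathrm{NBC}$), $H^*(F^{\mathrm{CS}}|_Q)$ is the cohomology of the cochain complex with $C^k=\bigoplus_{T\in Q,\,|T|=k}F^{\mathrm{CS}}(T)$ and differential $\delta^k=\sum c(T\lessdot T')F^{\mathrm{CS}}(T\lessdot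 T')$, summed over cover relations $T\lessdot T'$ in $Q$ with $|T|=k$. -}

module Defs where

open import Level using (0ℓ)
open import Algebra.Bundles using (AbelianGroup; CommutativeRing; Group)
open import Algebra.Module.Bundles using (LeftModule)
import Algebra.Module.Morphism.Structures
import Algebra.Properties.AbelianGroup as AbelianGroupProperties
import Algebra.Properties.CommutativeMonoid.Sum as Sums
import Algebra.Properties.CommutativeSemigroup as CommutativeSemigroupProperties
import Algebra.Properties.Ring as RingProperties
import Algebra.Properties.Semiring.Exp as Exponentiation
import Data.Bool as Bool
open import Data.Empty using (⊥; ⊥-elim)
open import Data.Fin using (Fin; zero; suc; toℕ)
import Data.Fin as Fin
import Data.Fin.Permutation as Perm
open Perm using (Permutation′; _⟨$⟩ʳ_; _⟨$⟩ˡ_)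
open import Data.Fin.Properties using (any?)
open import Data.Fin.Subset.Properties using (_∈?_; ⊆-refl; ⊆-trans; p─q⊆p; p─⊥≡p; p⊆p∪q)
open import Data.List using (List; []; _∷_; length; lookup; allFin; deduplicate)
import Data.List as List
open import Data.List.Membership.Propositional using () renaming (_∈_ to _∈ˡ_)
open import Data.List.Membership.Propositional.Properties using (∈-allFin)
open import Data.List.Relation.Unary.Any using (here; there)
open import Data.Nat using (ℕ; zero; suc)
import Data.Nat as ℕ
open import Data.Nat.DivMod using (_mod_)
import Data.Nat.Properties as ℕ
open import Data.Nat.Properties using (suc-injective)
open import Data.Product using (_×_; _,_; ∃-syntax)
open import Data.Rational using (ℚ; 0ℚ; 1ℚ; ½)
import Data.Rational.Properties as ℚP
open import Data.Sum using (_⊎_; inj₁; inj₂)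
open import Data.Unit using (⊤; tt)
open import Data.Vec using (Vec; _∷_; here; there)
import Data.Vec as Vec
open import Data.Vec.Properties using (≡-dec)
open import Function.Bundles using (_⇔_)
open import Function.Definitions using (Injective)
open import Relation.Binary.Core using (Rel)
open import Relation.Binary.Definitions using (Decidable)
open import Relation.Binary.PropositionalEquality as ≡ using (_≡_; _≢_; refl; cong)
import Relation.Binary.Reasoning.Setoid as SetoidReasoning
open import Relation.Binary.Structures using (IsEquivalence)
open import Relation.Nullary using (Dec; yes; no; does; ¬_)
open import Relation.Nullary.Decidable using (map′; _×-dec_; _⊎-dec_)

module RingIdentities (R : CommutativeRing 0ℓ 0ℓ) where

  open CommutativeRing R renaming (refl to ≈-refl; sym to ≈-sym; trans to ≈-trans)
  open AbelianGroupProperties +-abelianGroup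
  open RingProperties ring using (-‿distribˡ-*; -‿distribʳ-*)
  open CommutativeSemigroupProperties +-commutativeSemigroup using (interchange)
  open CommutativeSemigroupProperties *-commutativeSemigroup public using () renaming (x∙yz≈y∙xz to x*yz≈y*xz)
  open SetoidReasoning setoid

  neg-sub : ∀ a b → - (a - b) ≈ b - a
  neg-sub = ⁻¹-anti-homo‿-

  add-sub : ∀ a b → a ≈ b + (a - b)
  add-sub a b = ≈-sym (≈-trans (+-comm b (a - b)) (//-rightDividesˡ b a))

  telescope : ∀ a b c → a - c ≈ (a - b) + (b - c)
  telescope a b c = begin
    a + - c                  ≈⟨ +-congˡ (\\-leftDividesʳ b (- c)) ⟨
    a + (- b + (b + - c))    ≈⟨ +-assoc a (- b) (b + - c) ⟨
    (a - b) + (b - c)        ∎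

  sub-add : ∀ a b c d → (a + b) - (c + d) ≈ (a - c) + (b - d)
  sub-add a b c d = begin
    (a + b) + - (c + d)      ≈⟨ +-congˡ (⁻¹-∙-comm c d) ⟨
    (a + b) + (- c + - d)    ≈⟨ interchange a b (- c) (- d) ⟩
    (a - c) + (b - d)        ∎

  sub-neg : ∀ a b → b - a ≈ - a - (- b)
  sub-neg a b = begin
    b + - a                  ≈⟨ +-comm b (- a) ⟩
    - a + b                  ≈⟨ +-congˡ (⁻¹-involutive b) ⟨
    - a + - (- b)            ∎

  sub-mul : ∀ a b c d → a * b - c * d ≈ a * (b - d) + d * (a - c)
  sub-mul a b c d = begin
    a * b - c * d                             ≈⟨ telescope (a * b) (a * d) (c * d) ⟩
    (a * b - a * d) + (a * d - c * d)         ≈⟨ +-cong (+-congˡ (-‿distribʳ-* a d))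
                                                        (+-cong (*-comm a d) (-‿cong (*-comm c d))) ⟩
    (a * b + a * - d) + (d * a - d * c)       ≈⟨ +-cong (≈-sym (distribˡ a b (- d))) (+-congˡ (-‿distribʳ-* d c)) ⟩
    a * (b - d) + (d * a + d * - c)           ≈⟨ +-congˡ (distribˡ d a (- c)) ⟨
    a * (b - d) + d * (a - c)                 ∎

  -- the real and imaginary parts of ((a + b i)(c + d i))(e + f i)
  assoc-re : ∀ a b c d e f →
    (a * c - b * d) * e - (a * d + b * c) * f ≈ a * (c * e - d * f) - b * (c * f + d * e)
  assoc-re a b c d e f = begin
    (a * c - b * d) * e - (a * d + b * c) * f
      ≈⟨ +-cong (distribʳ e (a * c) (- (b * d))) (-‿cong (distribʳ f (a * d) (b * c))) ⟩
    (a * c * e + - (b * d) * e) - (a * d * f + b * c * f)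
      ≈⟨ sub-add (a * c * e) (- (b * d) * e) (a * d * f) (b * c * f) ⟩
    (a * c * e - a * d * f) + (- (b * d) * e - b * c * f)
      ≈⟨ +-cong (+-cong (*-assoc a c e) (-‿cong (*-assoc a d f)))
                (+-cong (≈-trans (≈-sym (-‿distribˡ-* (b * d) e)) (-‿cong (*-assoc b d e)))
                        (-‿cong (*-assoc b c f))) ⟩
    (a * (c * e) - a * (d * f)) + (- (b * (d * e)) - b * (c * f))
      ≈⟨ +-cong (+-congˡ (-‿distribʳ-* a (d * f)))
                (≈-trans (⁻¹-∙-comm (b * (d * e)) (b * (c * f)))
                         (-‿cong (+-comm (b * (d * e)) (b * (c * f))))) ⟩
    (a * (c * e) + a * - (d * f)) - (b * (c * f) + b * (d * e))
      ≈⟨ +-cong (distribˡ a (c * e) (- (d * f))) (-‿cong (distribˡ b (c * f) (d * e))) ⟨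
    a * (c * e - d * f) - b * (c * f + d * e) ∎

  assoc-im : ∀ a b c d e f →
    (a * c - b * d) * f + (a * d + b * c) * e ≈ a * (c * f + d * e) + b * (c * e - d * f)
  assoc-im a b c d e f = begin
    (a * c - b * d) * f + (a * d + b * c) * e
      ≈⟨ +-cong (distribʳ f (a * c) (- (b * d))) (distribʳ e (a * d) (b * c)) ⟩
    (a * c * f + - (b * d) * f) + (a * d * e + b * c * e)
      ≈⟨ interchange (a * c * f) (- (b * d) * f) (a * d * e) (b * c * e) ⟩
    (a * c * f + a * d * e) + (- (b * d) * f + b * c * e)
      ≈⟨ +-cong (+-cong (*-assoc a c f) (*-assoc a d e))
                (≈-trans (+-comm (- (b * d) * f) (b * c * e))
                         (+-cong (*-assoc b c e)
                                 (≈-trans (≈-sym (-‿distribˡ-* (b * d) f))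
                                 (≈-trans (-‿cong (*-assoc b d f)) (-‿distribʳ-* b (d * f)))))) ⟩
    (a * (c * f) + a * (d * e)) + (b * (c * e) + b * - (d * f))
      ≈⟨ +-cong (distribˡ a (c * f) (d * e)) (distribˡ b (c * e) (- (d * f))) ⟨
    a * (c * f + d * e) + b * (c * e - d * f) ∎

  identity-re : ∀ a b → 1# * a - 0# * b ≈ a
  identity-re a b = begin
    1# * a - 0# * b   ≈⟨ +-cong (*-identityˡ a) (≈-trans (-‿cong (zeroˡ b)) ε⁻¹≈ε) ⟩
    a + 0#            ≈⟨ +-identityʳ a ⟩
    a                 ∎

  identity-im : ∀ a b → 1# * b + 0# * a ≈ b
  identity-im a b = ≈-trans (+-cong (*-identityˡ b) (zeroˡ a)) (+-identityʳ b)

  distrib-re : ∀ a b c d e f → a * (c + e) - b * (d + f) ≈ (a * c - b * d) + (a * e - b * f)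
  distrib-re a b c d e f =
    ≈-trans (+-cong (distribˡ a c e) (-‿cong (distribˡ b d f))) (sub-add (a * c) (a * e) (b * d) (b * f))

  distrib-im : ∀ a b c d e f → a * (d + f) + b * (c + e) ≈ (a * d + b * c) + (a * f + b * e)
  distrib-im a b c d e f =
    ≈-trans (+-cong (distribˡ a d f) (distribˡ b c e)) (interchange (a * d) (a * f) (b * c) (b * e))

  comm-re : ∀ a b c d → a * c - b * d ≈ c * a - d * b
  comm-re a b c d = +-cong (*-comm a c) (-‿cong (*-comm b d))

  comm-im : ∀ a b c d → a * d + b * c ≈ c * b + d * a
  comm-im a b c d = ≈-trans (+-comm (a * d) (b * c)) (+-cong (*-comm b c) (*-comm a d))

module RealNumbers where

  open import Data.Rational using (_+_; _*_; -_; _-_; ∣_∣; _<_; _≤_; 1/_; positive)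
  open ℚP.≤-Reasoning

  -- Cauchy sequences of rationals, with a modulus of convergence, modulo null sequences
  record ℝ : Set where
    field
      seq    : ℕ → ℚ
      cauchy : ∀ ε → 0ℚ < ε →
               ∃[ N ] (∀ m n → N ℕ.≤ m → N ℕ.≤ n → ∣ seq m - seq n ∣ < ε)
  open ℝ public

  infix 4 _≈_
  _≈_ : ℝ → ℝ → Set
  x ≈ y = ∀ ε → 0ℚ < ε → ∃[ N ] (∀ n → N ℕ.≤ n → ∣ seq x n - seq y n ∣ < ε)

  private
    open RingIdentities ℚP.+-*-commutativeRing

    ½>0 : 0ℚ < ½
    ½>0 = ℚP.positive⁻¹ ½

    *-pos : ∀ {p q} → 0ℚ < p → 0ℚ < q → 0ℚ < p * q
    *-pos {p} {q} p>0 q>0 = ℚP.positive⁻¹ (p * q) {{ℚP.pos*pos⇒pos p {{positive p>0}} q {{positive q>0}}}}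

    half : ∀ {ε} → 0ℚ < ε → 0ℚ < ½ * ε
    half = *-pos ½>0

    halves : ∀ ε → ½ * ε + ½ * ε ≡ ε
    halves ε = ≡.trans (≡.sym (ℚP.*-distribʳ-+ ε ½ ½)) (ℚP.*-identityˡ ε)

    ∣p-p∣<ε : ∀ {p q ε} → p ≡ q → 0ℚ < ε → ∣ p - q ∣ < ε
    ∣p-p∣<ε {p} {ε = ε} refl ε>0 = ≡.subst (λ z → ∣ z ∣ < ε) (≡.sym (ℚP.+-inverseʳ p)) ε>0

    split : ∀ {a b c ε} → c ≡ a + b → ∣ a ∣ < ½ * ε → ∣ b ∣ < ½ * ε → ∣ c ∣ < ε
    split {a} {b} {c} {ε} refl a< b< = begin-strict
      ∣ a + b ∣       ≤⟨ ℚP.∣p+q∣≤∣p∣+∣q∣ a b ⟩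
      ∣ a ∣ + ∣ b ∣   <⟨ ℚP.+-mono-< a< b< ⟩
      ½ * ε + ½ * ε   ≡⟨ halves ε ⟩
      ε               ∎

    swap : ∀ p q → ∣ p - q ∣ ≡ ∣ q - p ∣
    swap p q = ≡.trans (≡.sym (ℚP.∣-p∣≡∣p∣ (p - q))) (cong ∣_∣ (neg-sub p q))

    Bounded : (ℕ → ℚ) → ℚ → ℕ → Set
    Bounded s B N = ∀ n → N ℕ.≤ n → ∣ s n ∣ ≤ B

    bound : ∀ x → ∃[ B ] ∃[ N ] (0ℚ < B × Bounded (seq x) B N)
    bound x with cauchy x 1ℚ (ℚP.positive⁻¹ 1ℚ)
    ... | N , close = ∣ seq x N ∣ + 1ℚ , N ,
                      ℚP.+-mono-≤-< (ℚP.0≤∣p∣ (seq x N)) (ℚP.positive⁻¹ 1ℚ) , bd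
      where
      bd : Bounded (seq x) (∣ seq x N ∣ + 1ℚ) N
      bd n N≤n = begin
        ∣ seq x n ∣                             ≡⟨ cong ∣_∣ (add-sub (seq x n) (seq x N)) ⟩
        ∣ seq x N + (seq x n - seq x N) ∣       ≤⟨ ℚP.∣p+q∣≤∣p∣+∣q∣ (seq x N) _ ⟩
        ∣ seq x N ∣ + ∣ seq x n - seq x N ∣     ≤⟨ ℚP.+-monoʳ-≤ ∣ seq x N ∣ (ℚP.<⇒≤ (close n N N≤n ℕ.≤-refl)) ⟩
        ∣ seq x N ∣ + 1ℚ                        ∎

    shrink : ∀ {B ε} → 0ℚ < B → 0ℚ < ε → ∃[ η ] (0ℚ < η × B * η ≡ ε)
    shrink {B} {ε} B>0 ε>0 =
      ε * (1/ B) ,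
      *-pos ε>0 (ℚP.positive⁻¹ (1/ B) {{ℚP.1/pos⇒pos B}}) ,
      ≡.trans (x*yz≈y*xz B ε (1/ B)) (≡.trans (cong (ε *_) (ℚP.*-inverseʳ B)) (ℚP.*-identityʳ ε))
      where
      instance
        B-pos = positive B>0
        B-nz = ℚP.pos⇒nonZero B

    scale< : ∀ {B a d η} → 0ℚ < B → ∣ a ∣ ≤ B → ∣ d ∣ < η → ∣ a * d ∣ < B * η
    scale< {B} {a} {d} {η} B>0 a≤ d< = begin-strict
      ∣ a * d ∣       ≡⟨ ℚP.∣p*q∣≡∣p∣*∣q∣ a d ⟩
      ∣ a ∣ * ∣ d ∣   ≤⟨ ℚP.*-monoʳ-≤-nonNeg ∣ d ∣ {{ℚP.∣-∣-nonNeg d}} a≤ ⟩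
      B * ∣ d ∣       <⟨ ℚP.*-monoʳ-<-pos B {{positive B>0}} d< ⟩
      B * η           ∎

    *-close : ∀ {B η ε} a b a′ b′ → 0ℚ < B → B * η ≡ ½ * ε → ∣ a ∣ ≤ B → ∣ b′ ∣ ≤ B →
              ∣ a - a′ ∣ < η → ∣ b - b′ ∣ < η → ∣ a * b - a′ * b′ ∣ < ε
    *-close a b a′ b′ B>0 eq a≤ b′≤ a< b< =
      split (sub-mul a b a′ b′) (≡.subst (_ <_) eq (scale< B>0 a≤ b<))
                            (≡.subst (_ <_) eq (scale< B>0 b′≤ a<))

    bound₂ : ∀ x y → ∃[ B ] ∃[ N ] (0ℚ < B × Bounded (seq x) B N × Bounded (seq y) B N)
    bound₂ x y = let (B , M , B>0 , bx) = bound x ; (C , N , C>0 , by) = bound y in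
      B + C , M ℕ.+ N , ℚP.+-mono-< B>0 C>0 ,
      (λ n le → begin
        ∣ seq x n ∣  ≤⟨ bx n (ℕ.m+n≤o⇒m≤o M le) ⟩
        B            ≡⟨ ℚP.+-identityʳ B ⟨
        B + 0ℚ       ≤⟨ ℚP.+-monoʳ-≤ B (ℚP.<⇒≤ C>0) ⟩
        B + C        ∎) ,
      (λ n le → begin
        ∣ seq y n ∣  ≤⟨ by n (ℕ.m+n≤o⇒n≤o M le) ⟩
        C            ≡⟨ ℚP.+-identityˡ C ⟨
        0ℚ + C       ≤⟨ ℚP.+-monoˡ-≤ C (ℚP.<⇒≤ B>0) ⟩
        B + C        ∎)

  infixl 6 _⊕_
  infixl 7 _⊗_

  _⊕_ : ℝ → ℝ → ℝ
  seq (x ⊕ y) n = seq x n + seq y n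
  cauchy (x ⊕ y) ε ε>0 with cauchy x (½ * ε) (half ε>0) | cauchy y (½ * ε) (half ε>0)
  ... | M , p | N , q = M ℕ.+ N , λ m n le le′ →
    split (sub-add (seq x m) (seq y m) (seq x n) (seq y n))
      (p m n (ℕ.m+n≤o⇒m≤o M le) (ℕ.m+n≤o⇒m≤o M le′))
      (q m n (ℕ.m+n≤o⇒n≤o M le) (ℕ.m+n≤o⇒n≤o M le′))

  ⊖_ : ℝ → ℝ
  seq (⊖ x) n = - seq x n
  cauchy (⊖ x) ε ε>0 with cauchy x ε ε>0
  ... | N , p = N , λ m n le le′ →
    ≡.subst (_< ε) (≡.trans (swap (seq x m) (seq x n)) (cong ∣_∣ (sub-neg (seq x m) (seq x n)))) (p m n le le′)

  _⊗_ : ℝ → ℝ → ℝ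
  seq (x ⊗ y) n = seq x n * seq y n
  cauchy (x ⊗ y) ε ε>0 =
    let (B , K , B>0 , bx , by) = bound₂ x y
        (η , η>0 , eq) = shrink B>0 (half ε>0)
        (M , p) = cauchy x η η>0
        (N , q) = cauchy y η η>0
    in K ℕ.+ (M ℕ.+ N) , λ m n le le′ →
    *-close (seq x m) (seq y m) (seq x n) (seq y n) B>0 eq
      (bx m (ℕ.m+n≤o⇒m≤o K le)) (by n (ℕ.m+n≤o⇒m≤o K le′))
      (p m n (ℕ.m+n≤o⇒m≤o M (ℕ.m+n≤o⇒n≤o K le)) (ℕ.m+n≤o⇒m≤o M (ℕ.m+n≤o⇒n≤o K le′)))
      (q m n (ℕ.m+n≤o⇒n≤o M (ℕ.m+n≤o⇒n≤o K le)) (ℕ.m+n≤o⇒n≤o M (ℕ.m+n≤o⇒n≤o K le′)))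

  fromℚ : ℚ → ℝ
  seq (fromℚ q) _ = q
  cauchy (fromℚ q) ε ε>0 = 0 , λ _ _ _ _ → ∣p-p∣<ε {q} refl ε>0

  private
    pointwise : ∀ {x y} → (∀ n → seq x n ≡ seq y n) → x ≈ y
    pointwise eq ε ε>0 = 0 , λ n _ → ∣p-p∣<ε (eq n) ε>0

    ≈-sym : ∀ {x y} → x ≈ y → y ≈ x
    ≈-sym {x} {y} p ε ε>0 with p ε ε>0
    ... | N , q = N , λ n le → ≡.subst (_< ε) (swap (seq x n) (seq y n)) (q n le)

    ≈-trans : ∀ {x y z} → x ≈ y → y ≈ z → x ≈ z
    ≈-trans {x} {y} {z} p q ε ε>0 with p (½ * ε) (half ε>0) | q (½ * ε) (half ε>0)
    ... | M , p′ | N , q′ = M ℕ.+ N , λ n le →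
      split (telescope (seq x n) (seq y n) (seq z n)) (p′ n (ℕ.m+n≤o⇒m≤o M le)) (q′ n (ℕ.m+n≤o⇒n≤o M le))

    ⊕-cong : ∀ {x x′ y y′} → x ≈ x′ → y ≈ y′ → x ⊕ y ≈ x′ ⊕ y′
    ⊕-cong {x} {x′} {y} {y′} p q ε ε>0 with p (½ * ε) (half ε>0) | q (½ * ε) (half ε>0)
    ... | M , p′ | N , q′ = M ℕ.+ N , λ n le →
      split (sub-add (seq x n) (seq y n) (seq x′ n) (seq y′ n)) (p′ n (ℕ.m+n≤o⇒m≤o M le)) (q′ n (ℕ.m+n≤o⇒n≤o M le))

    ⊖-cong : ∀ {x y} → x ≈ y → ⊖ x ≈ ⊖ y
    ⊖-cong {x} {y} p ε ε>0 with p ε ε>0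
    ... | N , q = N , λ n le →
      ≡.subst (_< ε) (≡.trans (swap (seq x n) (seq y n)) (cong ∣_∣ (sub-neg (seq x n) (seq y n)))) (q n le)

    ⊗-cong : ∀ {x x′ y y′} → x ≈ x′ → y ≈ y′ → x ⊗ y ≈ x′ ⊗ y′
    ⊗-cong {x} {x′} {y} {y′} p q ε ε>0 =
      let (B , K , B>0 , bx , by) = bound₂ x y′
          (η , η>0 , eq) = shrink B>0 (half ε>0)
          (M , p′) = p η η>0
          (N , q′) = q η η>0
      in K ℕ.+ (M ℕ.+ N) , λ n le →
      *-close (seq x n) (seq y n) (seq x′ n) (seq y′ n) B>0 eq
        (bx n (ℕ.m+n≤o⇒m≤o K le)) (by n (ℕ.m+n≤o⇒m≤o K le))
        (p′ n (ℕ.m+n≤o⇒m≤o M (ℕ.m+n≤o⇒n≤o K le)))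
        (q′ n (ℕ.m+n≤o⇒n≤o M (ℕ.m+n≤o⇒n≤o K le)))

  ℝ-commutativeRing : CommutativeRing 0ℓ 0ℓ
  ℝ-commutativeRing = record
    { Carrier = ℝ ; _≈_ = _≈_ ; _+_ = _⊕_ ; _*_ = _⊗_ ; -_ = ⊖_ ; 0# = fromℚ 0ℚ ; 1# = fromℚ 1ℚ
    ; isCommutativeRing = record
      { isRing = record
        { +-isAbelianGroup = record
          { isGroup = record
            { isMonoid = record
              { isSemigroup = record
                { isMagma = record
                  { isEquivalence = record
                    { refl  = λ {x} → pointwise {x} {x} λ _ → refl
                    ; sym   = λ {x} {y} → ≈-sym {x} {y}
                    ; trans = λ {x} {y} {z} → ≈-trans {x} {y} {z}
                    }
                  ; ∙-cong = λ {x} {x′} {y} {y′} → ⊕-cong {x} {x′} {y} {y′}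
                  }
                ; assoc = λ x y z → pointwise {(x ⊕ y) ⊕ z} {x ⊕ (y ⊕ z)} λ n → ℚP.+-assoc (seq x n) (seq y n) (seq z n)
                }
              ; identity = (λ x → pointwise {fromℚ 0ℚ ⊕ x} {x} λ n → ℚP.+-identityˡ (seq x n))
                         , (λ x → pointwise {x ⊕ fromℚ 0ℚ} {x} λ n → ℚP.+-identityʳ (seq x n))
              }
            ; inverse = (λ x → pointwise {⊖ x ⊕ x} {fromℚ 0ℚ} λ n → ℚP.+-inverseˡ (seq x n))
                      , (λ x → pointwise {x ⊕ ⊖ x} {fromℚ 0ℚ} λ n → ℚP.+-inverseʳ (seq x n))
            ; ⁻¹-cong = λ {x} {y} → ⊖-cong {x} {y}
            }
          ; comm = λ x y → pointwise {x ⊕ y} {y ⊕ x} λ n → ℚP.+-comm (seq x n) (seq y n)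
          }
        ; *-cong = λ {x} {x′} {y} {y′} → ⊗-cong {x} {x′} {y} {y′}
        ; *-assoc = λ x y z → pointwise {(x ⊗ y) ⊗ z} {x ⊗ (y ⊗ z)} λ n → ℚP.*-assoc (seq x n) (seq y n) (seq z n)
        ; *-identity = (λ x → pointwise {fromℚ 1ℚ ⊗ x} {x} λ n → ℚP.*-identityˡ (seq x n))
                     , (λ x → pointwise {x ⊗ fromℚ 1ℚ} {x} λ n → ℚP.*-identityʳ (seq x n))
        ; distrib = (λ x y z → pointwise {x ⊗ (y ⊕ z)} {x ⊗ y ⊕ x ⊗ z} λ n → ℚP.*-distribˡ-+ (seq x n) (seq y n) (seq z n))
                  , (λ x y z → pointwise {(y ⊕ z) ⊗ x} {y ⊗ x ⊕ z ⊗ x} λ n → ℚP.*-distribʳ-+ (seq x n) (seq y n) (seq z n))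
        }
      ; *-comm = λ x y → pointwise {x ⊗ y} {y ⊗ x} λ n → ℚP.*-comm (seq x n) (seq y n)
      }
    }

module Adjoin-i (R : CommutativeRing 0ℓ 0ℓ) where

  open CommutativeRing R renaming (refl to ≈-refl; sym to ≈-sym; trans to ≈-trans)

  private
    open RingIdentities R

    infix 4 _≈₂_
    _≈₂_ : Carrier × Carrier → Carrier × Carrier → Set
    (a , b) ≈₂ (c , d) = a ≈ c × b ≈ d

    infixl 6 _+₂_
    infixl 7 _*₂_

    _+₂_ _*₂_ : Carrier × Carrier → Carrier × Carrier → Carrier × Carrier
    (a , b) +₂ (c , d) = a + c , b + d
    (a , b) *₂ (c , d) = a * c - b * d , a * d + b * c

    ≈₂-trans : ∀ {x y z} → x ≈₂ y → y ≈₂ z → x ≈₂ z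
    ≈₂-trans (p , q) (p′ , q′) = ≈-trans p p′ , ≈-trans q q′

    +-cong₂ : ∀ {x y u v} → x ≈₂ y → u ≈₂ v → (x +₂ u) ≈₂ (y +₂ v)
    +-cong₂ (p , q) (p′ , q′) = +-cong p p′ , +-cong q q′

    *-id : ∀ z → ((1# , 0#) *₂ z) ≈₂ z
    *-id (a , b) = identity-re a b , identity-im a b

    *-comm₂ : ∀ z u → (z *₂ u) ≈₂ (u *₂ z)
    *-comm₂ (a , b) (c , d) = comm-re a b c d , comm-im a b c d

    *-distrib : ∀ z u v → (z *₂ (u +₂ v)) ≈₂ ((z *₂ u) +₂ (z *₂ v))
    *-distrib (a , b) (c , d) (e , f) = distrib-re a b c d e f , distrib-im a b c d e f

  -- (a , b) stands for a + b i
  R[i] : CommutativeRing 0ℓ 0ℓ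
  R[i] = record
    { Carrier = Carrier × Carrier
    ; _≈_ = _≈₂_
    ; _+_ = _+₂_
    ; _*_ = _*₂_
    ; -_  = λ (a , b) → - a , - b
    ; 0#  = 0# , 0#
    ; 1#  = 1# , 0#
    ; isCommutativeRing = record
      { isRing = record
        { +-isAbelianGroup = record
          { isGroup = record
            { isMonoid = record
              { isSemigroup = record
                { isMagma = record
                  { isEquivalence = record
                    { refl  = ≈-refl , ≈-refl
                    ; sym   = λ (p , q) → ≈-sym p , ≈-sym q
                    ; trans = λ {x} {y} {z} → ≈₂-trans {x} {y} {z}
                    }
                  ; ∙-cong = λ {x} {y} {u} {v} → +-cong₂ {x} {y} {u} {v}
                  }
                ; assoc = λ (a , b) (c , d) (e , f) → +-assoc a c e , +-assoc b d f
                }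
              ; identity = (λ (a , b) → +-identityˡ a , +-identityˡ b)
                         , (λ (a , b) → +-identityʳ a , +-identityʳ b)
              }
            ; inverse = (λ (a , b) → -‿inverseˡ a , -‿inverseˡ b)
                      , (λ (a , b) → -‿inverseʳ a , -‿inverseʳ b)
            ; ⁻¹-cong = λ (p , q) → -‿cong p , -‿cong q
            }
          ; comm = λ (a , b) (c , d) → +-comm a c , +-comm b d
          }
        ; *-cong = λ (p , q) (p′ , q′) →
                     +-cong (*-cong p p′) (-‿cong (*-cong q q′)) , +-cong (*-cong p q′) (*-cong q p′)
        ; *-assoc = λ (a , b) (c , d) (e , f) → assoc-re a b c d e f , assoc-im a b c d e f
        ; *-identity = *-id
                     , λ z → ≈₂-trans {z *₂ (1# , 0#)} {(1# , 0#) *₂ z} {z} (*-comm₂ z (1# , 0#)) (*-id z)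
        ; distrib = *-distrib
                  , λ z u v → ≈₂-trans {(u +₂ v) *₂ z} {z *₂ (u +₂ v)} {(u *₂ z) +₂ (v *₂ z)}
                      (*-comm₂ (u +₂ v) z)
                      (≈₂-trans {z *₂ (u +₂ v)} {(z *₂ u) +₂ (z *₂ v)} {(u *₂ z) +₂ (v *₂ z)}
                        (*-distrib z u v)
                        (+-cong₂ {z *₂ u} {u *₂ z} {z *₂ v} {v *₂ z} (*-comm₂ z u) (*-comm₂ z v)))
        }
      ; *-comm = *-comm₂
      }
    }

ℂ : CommutativeRing 0ℓ 0ℓ
ℂ = Adjoin-i.R[i] RealNumbers.ℝ-commutativeRing

open import Data.Fin.Subset using (Subset; inside; outside; Empty; _∈_; _∉_; _⊆_; _∪_; _∩_; _-_; ⁅_⁆; ∣_∣)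
open import Relation.Binary.Construct.Closure.ReflexiveTransitive using (Star; ε; _◅_; _◅◅_)

-- _∘ₚ_ composes from left to right; here (σ ∙ τ)(i) = σ (τ i).
Symmetric : ℕ → Group 0ℓ 0ℓ
Symmetric n = record
  { Carrier = Permutation′ n
  ; _≈_ = Perm._≈_
  ; _∙_ = λ σ τ → τ Perm.∘ₚ σ
  ; ε   = Perm.id
  ; _⁻¹ = Perm.flip
  ; isGroup = record
    { isMonoid = record
      { isSemigroup = record
        { isMagma = record
          { isEquivalence = record
            { refl = λ _ → refl ; sym = λ p i → ≡.sym (p i) ; trans = λ p q i → ≡.trans (p i) (q i) }
          ; ∙-cong = λ {σ} {σ′} {τ} {τ′} p q i → ≡.trans (p (τ ⟨$⟩ʳ i)) (cong (σ′ ⟨$⟩ʳ_) (q i)) }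
        ; assoc = λ _ _ _ _ → refl }
      ; identity = (λ _ _ → refl) , (λ _ _ → refl) }
    ; inverse = (λ σ _ → Perm.inverseˡ σ) , (λ σ _ → Perm.inverseʳ σ)
    ; ⁻¹-cong = λ {σ} {τ} p i → ≡.trans
        (cong (σ ⟨$⟩ˡ_) (≡.trans (≡.sym (Perm.inverseʳ τ)) (≡.sym (p (τ ⟨$⟩ˡ i)))))
        (Perm.inverseˡ σ) } }

-- Reachability is decidable on Fin n, by the Floyd–Warshall recursion: Via R ws u v asks for
-- a path from u to v whose inner vertices are in ws.
module _ {n : ℕ} {R : Rel (Fin n) 0ℓ} (R? : Decidable R) where

  private
    Via : List (Fin n) → Rel (Fin n) 0ℓ
    Via []       u v = u ≡ v ⊎ R u v
    Via (w ∷ ws) u v = Via ws u v ⊎ (Via ws u w × Via ws w v)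

    via? : ∀ ws → Decidable (Via ws)
    via? []       u v = (u Fin.≟ v) ⊎-dec R? u v
    via? (w ∷ ws) u v = via? ws u v ⊎-dec (via? ws u w ×-dec via? ws w v)

    sound : ∀ ws {u v} → Via ws u v → Star R u v
    sound []       (inj₁ refl)    = ε
    sound []       (inj₂ r)       = r ◅ ε
    sound (w ∷ ws) (inj₁ p)       = sound ws p
    sound (w ∷ ws) (inj₂ (p , q)) = sound ws p ◅◅ sound ws q

    direct : ∀ ws {u v} → u ≡ v ⊎ R u v → Via ws u v
    direct []       p = p
    direct (w ∷ ws) p = inj₁ (direct ws p)

    compose : ∀ {ws w u v} → w ∈ˡ ws → Via ws u w → Via ws w v → Via ws u v
    compose {a ∷ ws} (here refl) p q = inj₂ (toHub p , fromHub q)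
      where
      toHub : ∀ {u} → Via (a ∷ ws) u a → Via ws u a
      toHub (inj₁ p)       = p
      toHub (inj₂ (p , _)) = p
      fromHub : ∀ {v} → Via (a ∷ ws) a v → Via ws a v
      fromHub (inj₁ p)       = p
      fromHub (inj₂ (_ , p)) = p
    compose {a ∷ ws} (there w∈) (inj₁ p)       (inj₁ q)       = inj₁ (compose w∈ p q)
    compose {a ∷ ws} (there w∈) (inj₁ p)       (inj₂ (q , r)) = inj₂ (compose w∈ p q , r)
    compose {a ∷ ws} (there w∈) (inj₂ (p , q)) (inj₁ r)       = inj₂ (p , compose w∈ q r)
    compose {a ∷ ws} (there w∈) (inj₂ (p , _)) (inj₂ (_ , s)) = inj₂ (p , s)

    complete : ∀ {u v} → Star R u v → Via (allFin n) u v
    complete ε        = direct (allFin n) (inj₁ refl)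
    complete (r ◅ rs) = compose (∈-allFin _) (direct (allFin n) (inj₂ r)) (complete rs)

  star? : Decidable (Star R)
  star? u v = map′ (sound (allFin n)) complete (via? (allFin n) u v)

-- The vertices are Fin n; the edges e₀, …, e_{m-1} are distinct 2-element sets of vertices,
-- in the fixed order.  Sets of edges are elements of Subset m.
record Graph : Set where
  field
    n m            : ℕ
    edge           : Fin m → Subset n
    edge-size      : ∀ e → ∣ edge e ∣ ≡ 2
    edge-injective : Injective _≡_ _≡_ edge

next : ∀ {k} → Fin k → Fin k
next {suc k} i = suc (toℕ i) mod suc k

module _ (𝒢 : Graph) where

  open Graph 𝒢

  record IsCycle (C : Subset m) : Set where
    field
      len              : ℕ
      len≥3            : 3 ℕ.≤ len
      vertex           : Fin len → Fin n
      vertex-injective : Injective _≡_ _≡_ vertex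
      step             : Fin len → Fin m
      step-ends        : ∀ i → edge (step i) ≡ ⁅ vertex i ⁆ ∪ ⁅ vertex (next i) ⁆
      edges            : ∀ e → e ∈ C ⇔ (∃[ i ] step i ≡ e)

  BrokenCircuit : Subset m → Set
  BrokenCircuit B = ∃[ C ] ∃[ e ] (IsCycle C × e ∈ C × (∀ f → f ∈ C → f Fin.≤ e) × B ≡ C - e)

  NBC : Subset m → Set
  NBC S = ∀ B → BrokenCircuit B → ¬ (B ⊆ S)

  CompletesCycle : Subset m → Fin m → Set
  CompletesCycle T e = e ∉ T × ∃[ C ] (IsCycle C × e ∈ C × C ⊆ T ∪ ⁅ e ⁆)

  Adjacent : Subset m → Rel (Fin n) 0ℓ
  Adjacent T u v = ∃[ e ] (e ∈ T × edge e ≡ ⁅ u ⁆ ∪ ⁅ v ⁆)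

  Connected : Subset m → Rel (Fin n) 0ℓ
  Connected T = Star (Adjacent T)

  connected? : ∀ T → Decidable (Connected T)
  connected? T = star? λ u v → any? λ e → (e ∈? T) ×-dec (≡-dec Bool._≟_ (edge e) (⁅ u ⁆ ∪ ⁅ v ⁆))

  component : Subset m → Fin n → Subset n
  component T u = Vec.tabulate λ v → does (connected? T u v)

  -- Each component is listed once, in the order of the least elements.
  components : Subset m → List (Subset n)
  components T = deduplicate (≡-dec Bool._≟_) (List.map (component T) (allFin n))

∣p-x∣ : ∀ {m k} (p : Subset m) x → x ∈ p → ∣ p ∣ ≡ suc k → ∣ p - x ∣ ≡ k
∣p-x∣ (.inside ∷ p) zero    here        eq = ≡.trans (cong ∣_∣ (p─⊥≡p p)) (suc-injective eq)
∣p-x∣ {k = suc k} (inside ∷ p) (suc x) (there x∈p) eq = cong suc (∣p-x∣ p x x∈p (suc-injective eq))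
∣p-x∣ {k = zero} (inside ∷ p) (suc x) (there x∈p) eq = ⊥-elim (x∉ x∈p (∣p∣≡0⇒empty p (suc-injective eq)))
  where
  ∣p∣≡0⇒empty : ∀ {m} (p : Subset m) → ∣ p ∣ ≡ 0 → Empty p
  ∣p∣≡0⇒empty (outside ∷ p) eq (suc x , there x∈) = ∣p∣≡0⇒empty p eq (x , x∈)
  x∉ : x ∈ p → ¬ Empty p
  x∉ x∈ e = e (x , x∈)
∣p-x∣ (outside ∷ p) (suc x) (there x∈p) eq = ∣p-x∣ p x x∈p eq

module Representations (K : CommutativeRing 0ℓ 0ℓ) where

  private
    module K = CommutativeRing K
    open Sums K.+-commutativeMonoid using (sum; ∑-permute; ∑-distrib-+; sum-replicate-zero)
    open Exponentiation K.semiring using (_^_)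
    open Algebra.Module.Morphism.Structures using (module LeftModuleMorphisms)

  Scalar : Set
  Scalar = K.Carrier

  Module : Set₁
  Module = LeftModule K.ring 0ℓ 0ℓ

  -- The axioms of a module that do not follow from the others.
  record ModuleAxioms {A : Set} (_≈_ : Rel A 0ℓ) (_+_ : A → A → A) (𝟎 : A) (-_ : A → A)
                      (_*_ : Scalar → A → A) : Set where
    field
      isEquivalence : IsEquivalence _≈_
      +-cong        : ∀ {x x′ y y′} → x ≈ x′ → y ≈ y′ → (x + y) ≈ (x′ + y′)
      -‿cong        : ∀ {x x′} → x ≈ x′ → (- x) ≈ (- x′)
      *-cong        : ∀ {r r′ x x′} → r K.≈ r′ → x ≈ x′ → (r * x) ≈ (r′ * x′)
      +-assoc       : ∀ x y z → ((x + y) + z) ≈ (x + (y + z))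
      +-comm        : ∀ x y → (x + y) ≈ (y + x)
      +-identityˡ   : ∀ x → (𝟎 + x) ≈ x
      -‿inverseˡ    : ∀ x → ((- x) + x) ≈ 𝟎
      *-assoc       : ∀ r s x → ((r K.* s) * x) ≈ (r * (s * x))
      *-identityˡ   : ∀ x → (K.1# * x) ≈ x
      *-distribˡ    : ∀ r x y → (r * (x + y)) ≈ ((r * x) + (r * y))
      *-distribʳ    : ∀ x r s → ((r K.+ s) * x) ≈ ((r * x) + (s * x))

    private module E = IsEquivalence isEquivalence

    abelianGroup : AbelianGroup 0ℓ 0ℓ
    abelianGroup = record
      { _≈_ = _≈_ ; _∙_ = _+_ ; ε = 𝟎 ; _⁻¹ = -_
      ; isAbelianGroup = record
        { isGroup = record
          { isMonoid = record
            { isSemigroup = record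
              { isMagma = record { isEquivalence = isEquivalence ; ∙-cong = +-cong }
              ; assoc   = +-assoc }
            ; identity = +-identityˡ , λ x → E.trans (+-comm x 𝟎) (+-identityˡ x) }
          ; inverse = -‿inverseˡ , λ x → E.trans (+-comm x (- x)) (-‿inverseˡ x)
          ; ⁻¹-cong = -‿cong }
        ; comm = +-comm } }

    private
      module G = AbelianGroup abelianGroup
      module GP = AbelianGroupProperties abelianGroup

      zeroˡ : ∀ x → (K.0# * x) ≈ 𝟎
      zeroˡ x = GP.identityʳ-unique (K.0# * x) (K.0# * x)
        (E.trans (E.sym (*-distribʳ x K.0# K.0#)) (*-cong (K.+-identityˡ K.0#) E.refl))

      zeroʳ : ∀ r → (r * 𝟎) ≈ 𝟎
      zeroʳ r = GP.identityʳ-unique (r * 𝟎) (r * 𝟎)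
        (E.trans (E.sym (*-distribˡ r 𝟎 𝟎)) (*-cong K.refl (+-identityˡ 𝟎)))

    toModule : Module
    toModule .LeftModule.Carrierᴹ = A
    toModule .LeftModule._≈ᴹ_ = _≈_
    toModule .LeftModule._+ᴹ_ = _+_
    toModule .LeftModule._*ₗ_ = _*_
    toModule .LeftModule.0ᴹ = 𝟎
    toModule .LeftModule.-ᴹ_ = -_
    toModule .LeftModule.isLeftModule = record
        { isLeftSemimodule = record
          { +ᴹ-isCommutativeMonoid = G.isCommutativeMonoid
          ; isPreleftSemimodule = record
            { *ₗ-cong = *-cong ; *ₗ-zeroˡ = zeroˡ ; *ₗ-distribʳ = *-distribʳ
            ; *ₗ-identityˡ = *-identityˡ ; *ₗ-assoc = *-assoc ; *ₗ-zeroʳ = zeroʳ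
            ; *ₗ-distribˡ = *-distribˡ } }
        ; -ᴹ‿cong = -‿cong
        ; -ᴹ‿inverse = G.inverse }

  -- A module over the group algebra K[G], given as a K-module with a K-linear action of G.
  record Rep (G : Group 0ℓ 0ℓ) : Set₁ where
    private module G = Group G
    field
      space : Module
    open LeftModule space public
    infixr 7 _·_
    field
      _·_    : G.Carrier → Carrierᴹ → Carrierᴹ
      ·-cong : ∀ {g h x y} → g G.≈ h → x ≈ᴹ y → g · x ≈ᴹ h · y
      ·-+    : ∀ g x y → g · (x +ᴹ y) ≈ᴹ g · x +ᴹ g · y
      ·-*    : ∀ g r x → g · (r *ₗ x) ≈ᴹ r *ₗ (g · x)
      ·-ε    : ∀ x → G.ε · x ≈ᴹ x
      ·-∙    : ∀ g h x → (g G.∙ h) · x ≈ᴹ g · (h · x)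

  ∣_∣ᴿ : ∀ {G} → Rep G → Set
  ∣ V ∣ᴿ = Rep.Carrierᴹ V

  module _ {G : Group 0ℓ 0ℓ} where

    private module G = Group G

    infix 4 _⇒_ _≗_
    record _⇒_ (V W : Rep G) : Set where
      private
        module V = Rep V
        module W = Rep W
      field
        to       : ∣ V ∣ᴿ → ∣ W ∣ᴿ
        isLinear : LeftModuleMorphisms.IsLeftModuleHomomorphism V.rawLeftModule W.rawLeftModule to
        to-·     : ∀ g x → to (g V.· x) W.≈ᴹ g W.· to x
      open LeftModuleMorphisms.IsLeftModuleHomomorphism isLinear public
        renaming (⟦⟧-cong to to-cong; +ᴹ-homo to to-+; *ₗ-homo to to-*; 0ᴹ-homo to to-0; -ᴹ-homo to to-neg)
    open _⇒_ public using (to)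

    _≗_ : ∀ {V W} → V ⇒ W → V ⇒ W → Set
    _≗_ {W = W} f g = ∀ x → Rep._≈ᴹ_ W (to f x) (to g x)

    -- Linearity from the non-redundant conditions.
    module _ (V W : Rep G) where
      private
        module V = Rep V
        module W = Rep W

      linear : (f : ∣ V ∣ᴿ → ∣ W ∣ᴿ) →
               (∀ {x y} → x V.≈ᴹ y → f x W.≈ᴹ f y) →
               (∀ x y → f (x V.+ᴹ y) W.≈ᴹ f x W.+ᴹ f y) →
               (∀ r x → f (r V.*ₗ x) W.≈ᴹ r W.*ₗ f x) →
               LeftModuleMorphisms.IsLeftModuleHomomorphism V.rawLeftModule W.rawLeftModule f
      linear f f-cong f-+ f-* = record
        { +ᴹ-isGroupHomomorphism = record
          { isMonoidHomomorphism = record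
            { isMagmaHomomorphism = record
              { isRelHomomorphism = record { cong = f-cong } ; homo = f-+ }
            ; ε-homo = f-0 }
          ; ⁻¹-homo = f-neg }
        ; *ₗ-homo = f-* }
        where
        f-0 : f V.0ᴹ W.≈ᴹ W.0ᴹ
        f-0 = W.≈ᴹ-trans (f-cong (V.≈ᴹ-sym (V.*ₗ-zeroˡ V.0ᴹ)))
             (W.≈ᴹ-trans (f-* K.0# V.0ᴹ) (W.*ₗ-zeroˡ (f V.0ᴹ)))
        f-neg : ∀ x → f (V.-ᴹ x) W.≈ᴹ W.-ᴹ f x
        f-neg x = AbelianGroupProperties.inverseˡ-unique W.+ᴹ-abelianGroup (f (V.-ᴹ x)) (f x)
          (W.≈ᴹ-trans (W.≈ᴹ-sym (f-+ (V.-ᴹ x) x)) (W.≈ᴹ-trans (f-cong (V.-ᴹ‿inverseˡ x)) f-0))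

    idᴿ : ∀ {V} → V ⇒ V
    idᴿ {V} = record
      { to = λ x → x
      ; isLinear = linear V V (λ x → x) (λ p → p) (λ _ _ → V.≈ᴹ-refl) (λ _ _ → V.≈ᴹ-refl)
      ; to-· = λ _ _ → V.≈ᴹ-refl }
      where module V = Rep V

    infixr 9 _∘ᴿ_
    _∘ᴿ_ : ∀ {U V W} → V ⇒ W → U ⇒ V → U ⇒ W
    _∘ᴿ_ {U} {V} {W} f g = record
      { to = λ x → to f (to g x)
      ; isLinear = linear U W (λ x → to f (to g x))
          (λ p → f.to-cong (g.to-cong p))
          (λ x y → W.≈ᴹ-trans (f.to-cong (g.to-+ x y)) (f.to-+ (to g x) (to g y)))
          (λ r x → W.≈ᴹ-trans (f.to-cong (g.to-* r x)) (f.to-* r (to g x)))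
      ; to-· = λ h x → W.≈ᴹ-trans (f.to-cong (g.to-· h x)) (f.to-· h (to g x)) }
      where
      module W = Rep W
      module f = _⇒_ f
      module g = _⇒_ g

    zeroᴿ : ∀ {V W} → V ⇒ W
    zeroᴿ {V} {W} = record
      { to = λ _ → W.0ᴹ
      ; isLinear = linear V W (λ _ → W.0ᴹ) (λ _ → W.≈ᴹ-refl)
          (λ _ _ → W.≈ᴹ-sym (W.+ᴹ-identityˡ W.0ᴹ)) (λ r _ → W.≈ᴹ-sym (W.*ₗ-zeroʳ r))
      ; to-· = λ g _ → W.≈ᴹ-sym (W.≈ᴹ-trans (W.·-cong G.refl (W.≈ᴹ-sym (W.*ₗ-zeroˡ W.0ᴹ)))
                       (W.≈ᴹ-trans (W.·-* g K.0# W.0ᴹ) (W.*ₗ-zeroˡ (g W.· W.0ᴹ)))) }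
      where module W = Rep W

    infixl 6 _+ᴿ_
    _+ᴿ_ : ∀ {V W} → V ⇒ W → V ⇒ W → V ⇒ W
    _+ᴿ_ {V} {W} f g = record
      { to = λ x → to f x W.+ᴹ to g x
      ; isLinear = linear V W (λ x → to f x W.+ᴹ to g x)
          (λ p → W.+ᴹ-cong (f.to-cong p) (g.to-cong p))
          (λ x y → W.≈ᴹ-trans (W.+ᴹ-cong (f.to-+ x y) (g.to-+ x y))
                              (interchange (to f x) (to f y) (to g x) (to g y)))
          (λ r x → W.≈ᴹ-trans (W.+ᴹ-cong (f.to-* r x) (g.to-* r x))
                              (W.≈ᴹ-sym (W.*ₗ-distribˡ r (to f x) (to g x))))
      ; to-· = λ h x → W.≈ᴹ-trans (W.+ᴹ-cong (f.to-· h x) (g.to-· h x))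
                                  (W.≈ᴹ-sym (W.·-+ h (to f x) (to g x))) }
      where
      module W = Rep W
      module f = _⇒_ f
      module g = _⇒_ g
      open CommutativeSemigroupProperties (AbelianGroup.commutativeSemigroup W.+ᴹ-abelianGroup) using (interchange)

    infixr 7 _*ᴿ_
    _*ᴿ_ : ∀ {V W} → Scalar → V ⇒ W → V ⇒ W
    _*ᴿ_ {V} {W} r f = record
      { to = λ x → r W.*ₗ to f x
      ; isLinear = linear V W (λ x → r W.*ₗ to f x)
          (λ p → W.*ₗ-cong K.refl (f.to-cong p))
          (λ x y → W.≈ᴹ-trans (W.*ₗ-cong K.refl (f.to-+ x y)) (W.*ₗ-distribˡ r (to f x) (to f y)))
          (λ s x → W.≈ᴹ-trans (W.*ₗ-cong K.refl (f.to-* s x))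
                  (W.≈ᴹ-trans (W.≈ᴹ-sym (W.*ₗ-assoc r s (to f x)))
                  (W.≈ᴹ-trans (W.*ₗ-cong (K.*-comm r s) W.≈ᴹ-refl) (W.*ₗ-assoc s r (to f x)))))
      ; to-· = λ h x → W.≈ᴹ-trans (W.*ₗ-cong K.refl (f.to-· h x)) (W.≈ᴹ-sym (W.·-* h r (to f x))) }
      where
      module W = Rep W
      module f = _⇒_ f

    sumᴿ : ∀ {V W k} → (Fin k → V ⇒ W) → V ⇒ W
    sumᴿ {k = zero}  f = zeroᴿ
    sumᴿ {k = suc k} f = f zero +ᴿ sumᴿ (λ i → f (suc i))

    -- The product of a family; for a finite index set, its direct sum.
    Π : (I : Set) → (I → Rep G) → Rep G
    Π I V .Rep.space = ModuleAxioms.toModule {A = ∀ i → ∣ V i ∣ᴿ}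
          {_≈_ = λ x y → ∀ i → Rep._≈ᴹ_ (V i) (x i) (y i)}
          {_+_ = λ x y i → Rep._+ᴹ_ (V i) (x i) (y i)}
          {𝟎   = λ i → Rep.0ᴹ (V i)}
          { -_ = λ x i → Rep.-ᴹ_ (V i) (x i)}
          {_*_ = λ r x i → Rep._*ₗ_ (V i) r (x i)}
          record
          { isEquivalence = record
            { refl  = λ i → Rep.≈ᴹ-refl (V i)
            ; sym   = λ p i → Rep.≈ᴹ-sym (V i) (p i)
            ; trans = λ p q i → Rep.≈ᴹ-trans (V i) (p i) (q i) }
          ; +-cong      = λ p q i → Rep.+ᴹ-cong (V i) (p i) (q i)
          ; -‿cong      = λ p i → Rep.-ᴹ‿cong (V i) (p i)
          ; *-cong      = λ p q i → Rep.*ₗ-cong (V i) p (q i)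
          ; +-assoc     = λ x y z i → Rep.+ᴹ-assoc (V i) (x i) (y i) (z i)
          ; +-comm      = λ x y i → Rep.+ᴹ-comm (V i) (x i) (y i)
          ; +-identityˡ = λ x i → Rep.+ᴹ-identityˡ (V i) (x i)
          ; -‿inverseˡ  = λ x i → Rep.-ᴹ‿inverseˡ (V i) (x i)
          ; *-assoc     = λ r s x i → Rep.*ₗ-assoc (V i) r s (x i)
          ; *-identityˡ = λ x i → Rep.*ₗ-identityˡ (V i) (x i)
          ; *-distribˡ  = λ r x y i → Rep.*ₗ-distribˡ (V i) r (x i) (y i)
          ; *-distribʳ  = λ x r s i → Rep.*ₗ-distribʳ (V i) (x i) r s }
    Π I V .Rep._·_ = λ g x i → Rep._·_ (V i) g (x i)
    Π I V .Rep.·-cong = λ p q i → Rep.·-cong (V i) p (q i)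
    Π I V .Rep.·-+ = λ g x y i → Rep.·-+ (V i) g (x i) (y i)
    Π I V .Rep.·-* = λ g r x i → Rep.·-* (V i) g r (x i)
    Π I V .Rep.·-ε = λ x i → Rep.·-ε (V i) (x i)
    Π I V .Rep.·-∙ = λ g h x i → Rep.·-∙ (V i) g h (x i)

    proj : ∀ {I} (V : I → Rep G) (i : I) → Π I V ⇒ V i
    proj {I} V i = record
      { to = λ x → x i
      ; isLinear = linear (Π I V) (V i) (λ x → x i) (λ p → p i)
                     (λ _ _ → Rep.≈ᴹ-refl (V i)) (λ _ _ → Rep.≈ᴹ-refl (V i))
      ; to-· = λ _ _ → Rep.≈ᴹ-refl (V i) }

    tuple : ∀ {I V W} → (∀ i → W ⇒ V i) → W ⇒ Π I V
    tuple {I} {V} {W} f = record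
      { to = λ x i → to (f i) x
      ; isLinear = linear W (Π I V) (λ x i → to (f i) x) (λ p i → _⇒_.to-cong (f i) p)
                     (λ x y i → _⇒_.to-+ (f i) x y) (λ r x i → _⇒_.to-* (f i) r x)
      ; to-· = λ g x i → _⇒_.to-· (f i) g x }

    trivialZero : Rep G
    trivialZero = Π ⊥ (λ ())

    -- ker g / im f, for g ∘ f = 0: the elements of ker g, equal when they differ by an f a.
    module _ {A B C : Rep G} (f : A ⇒ B) (g : B ⇒ C) where
      private
        module A = Rep A
        module B = Rep B
        module C = Rep C
        module f = _⇒_ f
        module g = _⇒_ g
        open CommutativeSemigroupProperties (AbelianGroup.commutativeSemigroup B.+ᴹ-abelianGroup) using (interchange)
        module BP = AbelianGroupProperties B.+ᴹ-abelianGroup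

      record Cocycle : Set where
        constructor _,_
        field
          cochain : ∣ B ∣ᴿ
          closed  : to g cochain C.≈ᴹ C.0ᴹ
      open Cocycle public

      infix 4 _∼ᶜ_
      record _∼ᶜ_ (x y : Cocycle) : Set where
        constructor _,_
        field
          potential : ∣ A ∣ᴿ
          cobounds  : cochain x B.≈ᴹ cochain y B.+ᴹ to f potential
      open _∼ᶜ_ public

      private
        module CP = AbelianGroupProperties C.+ᴹ-abelianGroup

        ·-zero : ∀ h → h C.· C.0ᴹ C.≈ᴹ C.0ᴹ
        ·-zero h = C.≈ᴹ-sym (_⇒_.to-· (zeroᴿ {A} {C}) h A.0ᴹ)

        pointwise : ∀ {x y} → cochain x B.≈ᴹ cochain y → x ∼ᶜ y
        pointwise p = A.0ᴹ , B.≈ᴹ-trans p (B.≈ᴹ-sym (B.≈ᴹ-trans (B.+ᴹ-cong B.≈ᴹ-refl f.to-0) (B.+ᴹ-identityʳ _)))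

      ker/im : Rep G
      ker/im .Rep.space = ModuleAxioms.toModule {A = Cocycle} {_≈_ = _∼ᶜ_}
            {_+_ = λ x y → cochain x B.+ᴹ cochain y ,
                     C.≈ᴹ-trans (g.to-+ _ _) (C.≈ᴹ-trans (C.+ᴹ-cong (closed x) (closed y)) (C.+ᴹ-identityˡ _))}
            {𝟎   = B.0ᴹ , g.to-0}
            { -_ = λ x → (B.-ᴹ cochain x) ,
                     C.≈ᴹ-trans (g.to-neg _) (C.≈ᴹ-trans (C.-ᴹ‿cong (closed x)) CP.ε⁻¹≈ε)}
            {_*_ = λ r x → r B.*ₗ cochain x ,
                     C.≈ᴹ-trans (g.to-* r _) (C.≈ᴹ-trans (C.*ₗ-cong K.refl (closed x)) (C.*ₗ-zeroʳ r))}
            record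
            { isEquivalence = record
              { refl  = pointwise B.≈ᴹ-refl
              ; sym   = λ {x} {y} (a , p) → (A.-ᴹ a) ,
                  B.≈ᴹ-trans (B.≈ᴹ-sym (BP.//-rightDividesʳ (to f a) (cochain y)))
                             (B.+ᴹ-cong (B.≈ᴹ-sym p) (B.≈ᴹ-sym (f.to-neg a)))
              ; trans = λ (a , p) (b , q) → (b A.+ᴹ a) ,
                  B.≈ᴹ-trans p (B.≈ᴹ-trans (B.+ᴹ-cong q B.≈ᴹ-refl) (B.≈ᴹ-trans (B.+ᴹ-assoc _ _ _)
                    (B.+ᴹ-cong B.≈ᴹ-refl (B.≈ᴹ-sym (f.to-+ b a))))) }
            ; +-cong      = λ (a , p) (b , q) → (a A.+ᴹ b) ,
                B.≈ᴹ-trans (B.+ᴹ-cong p q) (B.≈ᴹ-trans (interchange _ _ _ _)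
                  (B.+ᴹ-cong B.≈ᴹ-refl (B.≈ᴹ-sym (f.to-+ a b))))
            ; -‿cong      = λ (a , p) → (A.-ᴹ a) ,
                B.≈ᴹ-trans (B.-ᴹ‿cong p) (B.≈ᴹ-trans (B.≈ᴹ-sym (BP.⁻¹-∙-comm _ _))
                  (B.+ᴹ-cong B.≈ᴹ-refl (B.≈ᴹ-sym (f.to-neg a))))
            ; *-cong      = λ {r} {r′} r≈ (a , p) → (r′ A.*ₗ a) ,
                B.≈ᴹ-trans (B.*ₗ-cong r≈ p) (B.≈ᴹ-trans (B.*ₗ-distribˡ r′ _ _)
                  (B.+ᴹ-cong B.≈ᴹ-refl (B.≈ᴹ-sym (f.to-* r′ a))))
            ; +-assoc     = λ x y z → pointwise (B.+ᴹ-assoc (cochain x) (cochain y) (cochain z))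
            ; +-comm      = λ x y → pointwise (B.+ᴹ-comm (cochain x) (cochain y))
            ; +-identityˡ = λ x → pointwise (B.+ᴹ-identityˡ (cochain x))
            ; -‿inverseˡ  = λ x → pointwise (B.-ᴹ‿inverseˡ (cochain x))
            ; *-assoc     = λ r s x → pointwise (B.*ₗ-assoc r s (cochain x))
            ; *-identityˡ = λ x → pointwise (B.*ₗ-identityˡ (cochain x))
            ; *-distribˡ  = λ r x y → pointwise (B.*ₗ-distribˡ r (cochain x) (cochain y))
            ; *-distribʳ  = λ x r s → pointwise (B.*ₗ-distribʳ (cochain x) r s) }
      ker/im .Rep._·_ = λ h x → h B.· cochain x ,
                     C.≈ᴹ-trans (g.to-· h _) (C.≈ᴹ-trans (C.·-cong G.refl (closed x)) (·-zero h))
      ker/im .Rep.·-cong {h} {h′} p (a , q) =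
        (h′ A.· a) ,
                     B.≈ᴹ-trans (B.·-cong p q) (B.≈ᴹ-trans (B.·-+ h′ _ _)
                       (B.+ᴹ-cong B.≈ᴹ-refl (B.≈ᴹ-sym (f.to-· h′ a))))
      ker/im .Rep.·-+ = λ h x y → pointwise (B.·-+ h (cochain x) (cochain y))
      ker/im .Rep.·-* = λ h r x → pointwise (B.·-* h r (cochain x))
      ker/im .Rep.·-ε = λ x → pointwise (B.·-ε (cochain x))
      ker/im .Rep.·-∙ = λ h h′ x → pointwise (B.·-∙ h h′ (cochain x))

  -- Formal K-linear combinations of generators.
  infixl 6 _⊞_
  infixr 7 _⊡_
  infixr 8 ⊟_
  data Comb (X : Set) : Set where
    ⟨_⟩ : X → Comb X
    𝟎   : Comb X
    _⊞_ : Comb X → Comb X → Comb X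
    ⊟_  : Comb X → Comb X
    _⊡_ : Scalar → Comb X → Comb X

  mapᶜ : ∀ {X Y} → (X → Y) → Comb X → Comb Y
  mapᶜ f ⟨ x ⟩   = ⟨ f x ⟩
  mapᶜ f 𝟎       = 𝟎
  mapᶜ f (s ⊞ t) = mapᶜ f s ⊞ mapᶜ f t
  mapᶜ f (⊟ s)   = ⊟ mapᶜ f s
  mapᶜ f (r ⊡ s) = r ⊡ mapᶜ f s

  -- The K-module with generators X and relations R.
  module _ {X : Set} (R : Rel (Comb X) 0ℓ) where

    infix 4 _≈ᶜ_
    data _≈ᶜ_ : Rel (Comb X) 0ℓ where
      relation    : ∀ {s t} → R s t → s ≈ᶜ t
      refl        : ∀ {s} → s ≈ᶜ s
      sym         : ∀ {s t} → s ≈ᶜ t → t ≈ᶜ s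
      trans       : ∀ {s t u} → s ≈ᶜ t → t ≈ᶜ u → s ≈ᶜ u
      ⊞-cong      : ∀ {s s′ t t′} → s ≈ᶜ s′ → t ≈ᶜ t′ → s ⊞ t ≈ᶜ s′ ⊞ t′
      ⊟-cong      : ∀ {s s′} → s ≈ᶜ s′ → ⊟ s ≈ᶜ ⊟ s′
      ⊡-cong      : ∀ {r r′ s s′} → r K.≈ r′ → s ≈ᶜ s′ → r ⊡ s ≈ᶜ r′ ⊡ s′
      ⊞-assoc     : ∀ s t u → (s ⊞ t) ⊞ u ≈ᶜ s ⊞ (t ⊞ u)
      ⊞-comm      : ∀ s t → s ⊞ t ≈ᶜ t ⊞ s
      ⊞-identityˡ : ∀ s → 𝟎 ⊞ s ≈ᶜ s
      ⊟-inverseˡ  : ∀ s → ⊟ s ⊞ s ≈ᶜ 𝟎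
      ⊡-assoc     : ∀ p q s → (p K.* q) ⊡ s ≈ᶜ p ⊡ (q ⊡ s)
      ⊡-identityˡ : ∀ s → K.1# ⊡ s ≈ᶜ s
      ⊡-distribˡ  : ∀ r s t → r ⊡ (s ⊞ t) ≈ᶜ r ⊡ s ⊞ r ⊡ t
      ⊡-distribʳ  : ∀ s p q → (p K.+ q) ⊡ s ≈ᶜ p ⊡ s ⊞ q ⊡ s

    presented : Module
    presented = ModuleAxioms.toModule {_≈_ = _≈ᶜ_} {_⊞_} {𝟎} {⊟_} {_⊡_} record
      { isEquivalence = record { refl = refl ; sym = sym ; trans = trans }
      ; +-cong = ⊞-cong ; -‿cong = ⊟-cong ; *-cong = ⊡-cong ; +-assoc = ⊞-assoc ; +-comm = ⊞-comm
      ; +-identityˡ = ⊞-identityˡ ; -‿inverseˡ = ⊟-inverseˡ ; *-assoc = ⊡-assoc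
      ; *-identityˡ = ⊡-identityˡ ; *-distribˡ = ⊡-distribˡ ; *-distribʳ = ⊡-distribʳ }

    -- An action of G on the generators that respects the relations extends linearly.
    module _ (G : Group 0ℓ 0ℓ) (act : Group.Carrier G → X → X)
             (act-relation : ∀ g {s t} → R s t → mapᶜ (act g) s ≈ᶜ mapᶜ (act g) t)
             (act-cong : ∀ {g h} → Group._≈_ G g h → ∀ x → ⟨ act g x ⟩ ≈ᶜ ⟨ act h x ⟩)
             (act-ε : ∀ x → ⟨ act (Group.ε G) x ⟩ ≈ᶜ ⟨ x ⟩)
             (act-∙ : ∀ g h x → ⟨ act (Group._∙_ G g h) x ⟩ ≈ᶜ ⟨ act g (act h x) ⟩) where
      private
        resp : ∀ g {s t} → s ≈ᶜ t → mapᶜ (act g) s ≈ᶜ mapᶜ (act g) t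
        resp g (relation p)       = act-relation g p
        resp g refl               = refl
        resp g (sym p)            = sym (resp g p)
        resp g (trans p q)        = trans (resp g p) (resp g q)
        resp g (⊞-cong p q)       = ⊞-cong (resp g p) (resp g q)
        resp g (⊟-cong p)         = ⊟-cong (resp g p)
        resp g (⊡-cong r p)       = ⊡-cong r (resp g p)
        resp g (⊞-assoc s t u)    = ⊞-assoc _ _ _
        resp g (⊞-comm s t)       = ⊞-comm _ _
        resp g (⊞-identityˡ s)    = ⊞-identityˡ _
        resp g (⊟-inverseˡ s)     = ⊟-inverseˡ _
        resp g (⊡-assoc p q s)    = ⊡-assoc p q _
        resp g (⊡-identityˡ s)    = ⊡-identityˡ _
        resp g (⊡-distribˡ r s t) = ⊡-distribˡ r _ _
        resp g (⊡-distribʳ s p q) = ⊡-distribʳ _ p q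

        lift₂ : ∀ {f h : X → X} → (∀ x → ⟨ f x ⟩ ≈ᶜ ⟨ h x ⟩) → ∀ s → mapᶜ f s ≈ᶜ mapᶜ h s
        lift₂ p ⟨ x ⟩   = p x
        lift₂ p 𝟎       = refl
        lift₂ p (s ⊞ t) = ⊞-cong (lift₂ p s) (lift₂ p t)
        lift₂ p (⊟ s)   = ⊟-cong (lift₂ p s)
        lift₂ p (r ⊡ s) = ⊡-cong K.refl (lift₂ p s)

        map-id : ∀ s → mapᶜ (λ x → x) s ≈ᶜ s
        map-id ⟨ x ⟩   = refl
        map-id 𝟎       = refl
        map-id (s ⊞ t) = ⊞-cong (map-id s) (map-id t)
        map-id (⊟ s)   = ⊟-cong (map-id s)
        map-id (r ⊡ s) = ⊡-cong K.refl (map-id s)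

        map-∘ : ∀ (f h : X → X) s → mapᶜ (λ x → f (h x)) s ≈ᶜ mapᶜ f (mapᶜ h s)
        map-∘ f h ⟨ x ⟩   = refl
        map-∘ f h 𝟎       = refl
        map-∘ f h (s ⊞ t) = ⊞-cong (map-∘ f h s) (map-∘ f h t)
        map-∘ f h (⊟ s)   = ⊟-cong (map-∘ f h s)
        map-∘ f h (r ⊡ s) = ⊡-cong K.refl (map-∘ f h s)

      presentedRep : Rep G
      presentedRep .Rep.space = presented
      presentedRep .Rep._·_ = λ g → mapᶜ (act g)
      presentedRep .Rep.·-cong {g} {h} {x} p q =
        trans (lift₂ (act-cong p) x) (resp h q)
      presentedRep .Rep.·-+ = λ _ _ _ → refl
      presentedRep .Rep.·-* = λ _ _ _ → refl
      presentedRep .Rep.·-ε = λ s → trans (lift₂ act-ε s) (map-id s)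
      presentedRep .Rep.·-∙ = λ g h s → trans (lift₂ (act-∙ g h) s) (map-∘ (act g) (act h) s)

  module _ {G : Group 0ℓ 0ℓ} where

    private module G = Group G

    -- The relation z = x + y (resp. z = r x) is imposed when x, y and z agree outside
    -- the slot i and their i-th entries satisfy it.
    data Multilinear {r} (V : Fin r → Rep G) : Rel (Comb (∀ i → ∣ V i ∣ᴿ)) 0ℓ where
      resp  : ∀ {x y} → (∀ i → Rep._≈ᴹ_ (V i) (x i) (y i)) → Multilinear V ⟨ x ⟩ ⟨ y ⟩
      plus  : ∀ i {x y z} →
              (∀ j → j ≢ i → Rep._≈ᴹ_ (V j) (z j) (x j)) →
              (∀ j → j ≢ i → Rep._≈ᴹ_ (V j) (z j) (y j)) →
              Rep._≈ᴹ_ (V i) (z i) (Rep._+ᴹ_ (V i) (x i) (y i)) →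
              Multilinear V ⟨ z ⟩ (⟨ x ⟩ ⊞ ⟨ y ⟩)
      scale : ∀ i c {x z} →
              (∀ j → j ≢ i → Rep._≈ᴹ_ (V j) (z j) (x j)) →
              Rep._≈ᴹ_ (V i) (z i) (Rep._*ₗ_ (V i) c (x i)) →
              Multilinear V ⟨ z ⟩ (c ⊡ ⟨ x ⟩)

    private
      diagonal : ∀ {r} (V : Fin r → Rep G) → G.Carrier → (∀ i → ∣ V i ∣ᴿ) → ∀ i → ∣ V i ∣ᴿ
      diagonal V g x i = Rep._·_ (V i) g (x i)

      diagonal-multilinear : ∀ {r} (V : Fin r → Rep G) g {s t} → Multilinear V s t →
                             Multilinear V (mapᶜ (diagonal V g) s) (mapᶜ (diagonal V g) t)
      diagonal-multilinear V g (resp p) = resp λ i → Rep.·-cong (V i) G.refl (p i)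
      diagonal-multilinear V g (plus i p q e) = plus i
        (λ j n → Rep.·-cong (V j) G.refl (p j n)) (λ j n → Rep.·-cong (V j) G.refl (q j n))
        (Rep.≈ᴹ-trans (V i) (Rep.·-cong (V i) G.refl e) (Rep.·-+ (V i) g _ _))
      diagonal-multilinear V g (scale i c p e) = scale i c
        (λ j n → Rep.·-cong (V j) G.refl (p j n))
        (Rep.≈ᴹ-trans (V i) (Rep.·-cong (V i) G.refl e) (Rep.·-* (V i) g c _))

    ⨂ : ∀ {r} → (Fin r → Rep G) → Rep G
    ⨂ V = presentedRep (Multilinear V) G (diagonal V)
      (λ g p → relation (diagonal-multilinear V g p))
      (λ p x → relation (resp λ i → Rep.·-cong (V i) p (Rep.≈ᴹ-refl (V i))))
      (λ x → relation (resp λ i → Rep.·-ε (V i) (x i)))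
      (λ g h x → relation (resp λ i → Rep.·-∙ (V i) g h (x i)))

    data Alternating (k : ℕ) (V : Rep G) : Rel (Comb (Fin k → ∣ V ∣ᴿ)) 0ℓ where
      multilinear : ∀ {s t} → Multilinear (λ _ → V) s t → Alternating k V s t
      repeated    : ∀ {x i j} → i ≢ j → Rep._≈ᴹ_ V (x i) (x j) → Alternating k V ⟨ x ⟩ 𝟎

    ⋀ : ℕ → Rep G → Rep G
    ⋀ k V = presentedRep (Alternating k V) G (diagonal (λ _ → V))
      (λ g → λ { (multilinear p)    → relation (multilinear (diagonal-multilinear (λ _ → V) g p))
               ; (repeated i≢j eq) → relation (repeated i≢j (V.·-cong G.refl eq)) })
      (λ p x → relation (multilinear (resp λ i → V.·-cong p V.≈ᴹ-refl)))
      (λ x → relation (multilinear (resp λ i → V.·-ε (x i))))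
      (λ g h x → relation (multilinear (resp λ i → V.·-∙ g h (x i))))
      where module V = Rep V

  -- The induced module K[G] ⊗_{K[H]} W along ι : H → G; (g , w) stands for g ⊗ w.
  module _ {G H : Group 0ℓ 0ℓ} (ι : Group.Carrier H → Group.Carrier G) (W : Rep H) where

    private
      module G = Group G
      module W = Rep W

    data Balanced : Rel (Comb (G.Carrier × ∣ W ∣ᴿ)) 0ℓ where
      resp    : ∀ {g g′ w w′} → g G.≈ g′ → w W.≈ᴹ w′ → Balanced ⟨ g , w ⟩ ⟨ g′ , w′ ⟩
      plus    : ∀ {g w w′} → Balanced ⟨ g , w W.+ᴹ w′ ⟩ (⟨ g , w ⟩ ⊞ ⟨ g , w′ ⟩)
      scale   : ∀ {g c w} → Balanced ⟨ g , c W.*ₗ w ⟩ (c ⊡ ⟨ g , w ⟩)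
      balance : ∀ {g h w} → Balanced ⟨ g G.∙ ι h , w ⟩ ⟨ g , h W.· w ⟩

    Ind : Rep G
    Ind = presentedRep Balanced G (λ { g (g′ , w) → g G.∙ g′ , w })
      (λ g → λ { (resp p q) → relation (resp (G.∙-cong G.refl p) q)
               ; plus       → relation plus
               ; scale      → relation scale
               ; balance    → trans (relation (resp (G.sym (G.assoc _ _ _)) W.≈ᴹ-refl)) (relation balance) })
      (λ { p (_ , _) → relation (resp (G.∙-cong p G.refl) W.≈ᴹ-refl) })
      (λ { (g , _) → relation (resp (G.identityˡ g) W.≈ᴹ-refl) })
      (λ { g h (g′ , _) → relation (resp (G.assoc g h g′) W.≈ᴹ-refl) })

  GradedRep : Group 0ℓ 0ℓ → Set₁
  GradedRep G = ℕ → Rep G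

  module _ {G : Group 0ℓ 0ℓ} where

    infix 4 _⇒ᵍ_ _≗ᵍ_ _≅ᵍ_
    infixr 9 _∘ᵍ_

    _⇒ᵍ_ : GradedRep G → GradedRep G → Set
    V ⇒ᵍ W = ∀ d → V d ⇒ W d

    _≗ᵍ_ : ∀ {V W} → V ⇒ᵍ W → V ⇒ᵍ W → Set
    f ≗ᵍ g = ∀ d → f d ≗ g d

    idᵍ : ∀ {V} → V ⇒ᵍ V
    idᵍ d = idᴿ

    _∘ᵍ_ : ∀ {U V W} → V ⇒ᵍ W → U ⇒ᵍ V → U ⇒ᵍ W
    (f ∘ᵍ g) d = f d ∘ᴿ g d

    record _≅ᵍ_ (V W : GradedRep G) : Set where
      field
        forward           : V ⇒ᵍ W
        backward          : W ⇒ᵍ V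
        backward∘forward  : backward ∘ᵍ forward ≗ᵍ idᵍ {V}
        forward∘backward  : forward ∘ᵍ backward ≗ᵍ idᵍ {W}

    -- There are finitely many multidegrees of a given total degree, so the product below is
    -- the direct sum.  No signs occur: the group acts on each factor separately.
    record Multidegree (r d : ℕ) : Set where
      field
        degrees : Vec ℕ r
        .total  : Vec.sum degrees ≡ d

    ⨂ᵍ : ∀ {r} → (Fin r → GradedRep G) → GradedRep G
    ⨂ᵍ {r} V d = Π (Multidegree r d) λ a → ⨂ (λ i → V i (Vec.lookup (Multidegree.degrees a) i))

  Indᵍ : ∀ {G H : Group 0ℓ 0ℓ} → (Group.Carrier H → Group.Carrier G) → GradedRep H → GradedRep G
  Indᵍ {G} ι W d = Ind {G} ι (W d)

  -- used for set partitions of Fin n, listed by their blocks B₁, …, B_r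
  Blocks : ℕ → Set
  Blocks n = List (Subset n)

  -- S_{B₁} × ⋯ × S_{B_r} as the subgroup of permutations that map every block to itself
  record YoungElement {n} (π : Blocks n) : Set where
    field
      perm  : Permutation′ n
      stays : ∀ i {x} → x ∈ lookup π i → (perm ⟨$⟩ʳ x) ∈ lookup π i
      back  : ∀ i {x} → x ∈ lookup π i → (perm ⟨$⟩ˡ x) ∈ lookup π i
  open YoungElement public using (perm)

  Young : ∀ {n} → Blocks n → Group 0ℓ 0ℓ
  Young {n} π = record
    { Carrier = YoungElement π
    ; _≈_ = λ σ τ → perm σ S.≈ perm τ
    ; _∙_ = λ σ τ → record { perm  = perm σ S.∙ perm τ
                           ; stays = λ i x∈ → stays σ i (stays τ i x∈)
                           ; back  = λ i x∈ → back τ i (back σ i x∈) }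
    ; ε   = record { perm = S.ε ; stays = λ _ x∈ → x∈ ; back = λ _ x∈ → x∈ }
    ; _⁻¹ = λ σ → record { perm = perm σ S.⁻¹ ; stays = back σ ; back = stays σ }
    ; isGroup = record
      { isMonoid = record
        { isSemigroup = record
          { isMagma = record
            { isEquivalence = record
              { refl = λ _ → refl ; sym = λ p i → ≡.sym (p i) ; trans = λ p q i → ≡.trans (p i) (q i) }
            ; ∙-cong = λ {σ} {σ′} {τ} {τ′} → S.∙-cong {perm σ} {perm σ′} {perm τ} {perm τ′} }
          ; assoc = λ σ τ ρ → S.assoc (perm σ) (perm τ) (perm ρ) }
        ; identity = (λ σ → S.identityˡ (perm σ)) , λ σ → S.identityʳ (perm σ) }
      ; inverse = (λ σ → S.inverseˡ (perm σ)) , λ σ → S.inverseʳ (perm σ)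
      ; ⁻¹-cong = λ {σ} {τ} → S.⁻¹-cong {perm σ} {perm τ} } }
    where
    module S = Group (Symmetric n)
    open YoungElement

  -- S^{(b-1,1)} for the symmetric group on a block B with b elements: the functions on B
  -- with sum zero.  A function on B is extended by zero to Fin n.
  record SumZero {n} (B : Subset n) : Set where
    constructor sumZero
    field
      value    : Fin n → Scalar
      support  : ∀ x → x ∉ B → value x K.≈ K.0#
      sum-zero : sum value K.≈ K.0#

  module _ {n} (π : Blocks n) (i : Fin (length π)) where

    private
      open SumZero
      B = lookup π i
      module G = Group (Young π)
      module E = IsEquivalence K.isEquivalence
      module KG = AbelianGroupProperties K.+-abelianGroup

      sum-* : ∀ {k} r (f : Fin k → Scalar) → sum (λ x → r K.* f x) K.≈ r K.* sum f
      sum-* {zero}  r f = K.sym (K.zeroʳ r)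
      sum-* {suc k} r f = K.trans (K.+-congˡ (sum-* r (λ x → f (suc x)))) (K.sym (K.distribˡ r _ _))

      sum-neg : ∀ {k} (f : Fin k → Scalar) → sum (λ x → K.- f x) K.≈ K.- sum f
      sum-neg {zero}  f = K.sym KG.ε⁻¹≈ε
      sum-neg {suc k} f = K.trans (K.+-congˡ (sum-neg (λ x → f (suc x)))) (KG.⁻¹-∙-comm _ _)

      permuted : YoungElement π → SumZero B → SumZero B
      permuted σ f = sumZero (λ x → value f (perm σ ⟨$⟩ˡ x))
        (λ x x∉ → support f _ λ ∈B → x∉ (≡.subst (_∈ B) (Perm.inverseʳ (perm σ)) (YoungElement.stays σ i ∈B)))
        (K.trans (K.sym (∑-permute (value f) (Perm.flip (perm σ)))) (sum-zero f))

    -- (σ₁ , … , σ_r) acts through its component σᵢ, by (σ f)(x) = f (σ⁻¹ x).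
    standard : Rep (Young π)
    standard .Rep.space = ModuleAxioms.toModule {A = SumZero B}
          {_≈_ = λ f g → ∀ x → value f x K.≈ value g x}
          {_+_ = λ f g → sumZero (λ x → value f x K.+ value g x)
            (λ x x∉ → K.trans (K.+-cong (support f x x∉) (support g x x∉)) (K.+-identityˡ _))
            (K.trans (∑-distrib-+ (value f) (value g))
              (K.trans (K.+-cong (sum-zero f) (sum-zero g)) (K.+-identityˡ _)))}
          {𝟎   = sumZero (λ _ → K.0#) (λ _ _ → K.refl) (sum-replicate-zero n)}
          { -_ = λ f → sumZero (λ x → K.- value f x)
            (λ x x∉ → K.trans (K.-‿cong (support f x x∉)) KG.ε⁻¹≈ε)
            (K.trans (sum-neg (value f)) (K.trans (K.-‿cong (sum-zero f)) KG.ε⁻¹≈ε))}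
          {_*_ = λ r f → sumZero (λ x → r K.* value f x)
            (λ x x∉ → K.trans (K.*-congˡ (support f x x∉)) (K.zeroʳ r))
            (K.trans (sum-* r (value f)) (K.trans (K.*-congˡ (sum-zero f)) (K.zeroʳ r)))}
          record
          { isEquivalence = record
            { refl = λ _ → K.refl ; sym = λ p x → K.sym (p x) ; trans = λ p q x → K.trans (p x) (q x) }
          ; +-cong      = λ p q x → K.+-cong (p x) (q x)
          ; -‿cong      = λ p x → K.-‿cong (p x)
          ; *-cong      = λ r p x → K.*-cong r (p x)
          ; +-assoc     = λ f g h x → K.+-assoc _ _ _
          ; +-comm      = λ f g x → K.+-comm _ _
          ; +-identityˡ = λ f x → K.+-identityˡ _
          ; -‿inverseˡ  = λ f x → K.-‿inverseˡ _
          ; *-assoc     = λ r s f x → K.*-assoc _ _ _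
          ; *-identityˡ = λ f x → K.*-identityˡ _
          ; *-distribˡ  = λ r f g x → K.distribˡ _ _ _
          ; *-distribʳ  = λ f r s x → K.distribʳ _ _ _ }
    standard .Rep._·_ = permuted
    standard .Rep.·-cong {σ} {τ} {f} {g} p q x =
      K.trans (K.reflexive (≡.cong (value f) (G.⁻¹-cong {σ} {τ} p x))) (q _)
    standard .Rep.·-+ = λ _ _ _ _ → K.refl
    standard .Rep.·-* = λ _ _ _ _ → K.refl
    standard .Rep.·-ε = λ _ _ → K.refl
    standard .Rep.·-∙ = λ _ _ _ _ → K.refl

    -- The module 𝓛_b for b = ∣ Bᵢ ∣, transported to the symmetric group of the block Bᵢ.
    𝓛 : GradedRep (Young π)
    𝓛 k = ⋀ k standard

  𝓜 : ∀ {n} → Blocks n → GradedRep (Symmetric n)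
  𝓜 {n} π = Indᵍ {Symmetric n} {Young π} perm (⨂ᵍ (𝓛 π))

  𝓜-identity : ∀ {n} {π π′ : Blocks n} → π ≡ π′ → 𝓜 π ⇒ᵍ 𝓜 π′
  𝓜-identity refl = idᵍ

  -- A functor from the Boolean lattice 2^[m] to graded modules.  A hom-set of the lattice has
  -- at most one element, hence the irrelevant argument.
  record BooleanFunctor (m : ℕ) (G : Group 0ℓ 0ℓ) : Set₁ where
    field
      F₀           : Subset m → GradedRep G
      F₁           : ∀ {S T} → .(S ⊆ T) → F₀ S ⇒ᵍ F₀ T
      identity     : ∀ {S} → F₁ {S} {S} ⊆-refl ≗ᵍ idᵍ
      homomorphism : ∀ {S T U} (p : S ⊆ T) (q : T ⊆ U) → F₁ {S} {U} (⊆-trans p q) ≗ᵍ F₁ q ∘ᵍ F₁ p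

  record LowerIdeal (m : ℕ) : Set₁ where
    field
      Member : Subset m → Set
      lower  : ∀ {S T} → S ⊆ T → Member T → Member S

  2ᴱ : ∀ {m} → LowerIdeal m
  2ᴱ = record { Member = λ _ → ⊤ ; lower = λ _ _ → tt }

  module Cohomology {m G} (F : BooleanFunctor m G) (Q : LowerIdeal m) where

    open BooleanFunctor F
    open LowerIdeal Q

    -- Membership is irrelevant, so that an element of Q of rank k is determined by its set.
    record Cell (k : ℕ) : Set where
      constructor cell
      field
        set     : Subset m
        .member : Member set
        .rank   : ∣ set ∣ ≡ k
    open Cell public

    -- There are finitely many cells, so the product is the direct sum.
    C : ℕ → GradedRep G
    C k d = Π (Cell k) λ T → F₀ (set T) d

    -- #{ eⱼ ∈ T : j < i }
    #below : Fin m → Subset m → ℕ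
    #below i T = ∣ T ∩ Vec.tabulate (λ j → does (j Fin.<? i)) ∣

    sign : Fin m → Subset m → Scalar
    sign i T = (K.- K.1#) ^ #below i T

    remove : ∀ {k} (T : Cell (suc k)) i → .(i ∈ set T) → Cell k
    remove (cell T Q∋T ∣T∣) i i∈T =
      cell (T - i) (lower (p─q⊆p T ⁅ i ⁆) Q∋T) (∣p-x∣ T i i∈T ∣T∣)

    -- the component C k → F(T) of the differential coming from the cover relation T - i ⋖ T
    face : ∀ {k} d (T : Cell (suc k)) i → Dec (i ∈ set T) → C k d ⇒ F₀ (set T) d
    face d T i (yes i∈T) =
      sign i (set T - i) *ᴿ (F₁ (p─q⊆p (set T) ⁅ i ⁆) d ∘ᴿ proj (λ T′ → F₀ (set T′) d) (remove T i i∈T))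
    face d T i (no  _)   = zeroᴿ

    δ : ∀ k → C k ⇒ᵍ C (suc k)
    δ k d = tuple λ T → sumᴿ λ i → face d T i (i ∈? set T)

    H : ℕ → GradedRep G
    H zero    d = ker/im {A = trivialZero} zeroᴿ (δ 0 d)
    H (suc k) d = ker/im (δ k d) (δ (suc k) d)

  module _ (𝒢 : Graph) where

    open Graph 𝒢

    NBC-ideal : LowerIdeal m
    NBC-ideal = record { Member = NBC 𝒢 ; lower = λ S⊆T T∈ C bc C⊆S → T∈ C bc (⊆-trans C⊆S S⊆T) }

    -- Any functor with the prescribed values on objects and on the cover relations that
    -- complete a cycle; on the others d is an arbitrary morphism of graded modules.
    record ChromaticSymmetricFunctor : Set where
      field
        d            : ∀ {S T} → .(S ⊆ T) → 𝓜 (components 𝒢 S) ⇒ᵍ 𝓜 (components 𝒢 T)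
        identity     : ∀ {S} → d {S} {S} ⊆-refl ≗ᵍ idᵍ
        homomorphism : ∀ {S T U} (p : S ⊆ T) (q : T ⊆ U) → d {S} {U} (⊆-trans p q) ≗ᵍ d q ∘ᵍ d p
        -- When e completes a cycle, T and T ∪ {e} have the same components.
        cycle        : ∀ T e → CompletesCycle 𝒢 T e →
                       (same : components 𝒢 T ≡ components 𝒢 (T ∪ ⁅ e ⁆)) →
                       d (p⊆p∪q ⁅ e ⁆) ≗ᵍ 𝓜-identity same

      functor : BooleanFunctor m (Symmetric n)
      functor = record
        { F₀ = λ T → 𝓜 (components 𝒢 T) ; F₁ = d ; identity = identity ; homomorphism = homomorphism }

open Representations ℂ public

{-# OPTIONS --safe #-}
module Submission where

-- Call S broken at e when C ∖ {e} ⊆ S for a cycle C whose largest edge is e; NBC consists of the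
-- sets broken nowhere.  Being broken at f depends only on the edges smaller than f, so adding or
-- removing e does not change at which f ≤ e a set is broken.  If S is broken at e ∉ S, then e
-- completes a cycle and F(S ⋖ S ∪ {e}) is an isomorphism.  Toggling the first edge at which S is
-- broken is therefore an acyclic matching of 2ᴱ ∖ NBC along isomorphisms, so the cochains that
-- vanish on NBC form an acyclic complex, the kernel of the restriction map from 2ᴱ to NBC.

open import Defs using (module Representations)
open import Data.Nat using (ℕ)
open import Level using (0ℓ)
open import Algebra.Bundles using (CommutativeRing; Group; CommutativeMonoid)
import Algebra.Properties.AbelianGroup as AbelianGroupProperties
import Algebra.Properties.CommutativeMonoid.Sum as Sums
import Algebra.Properties.Ring as RingProperties
import Algebra.Properties.Semiring.Exp as Exponentiation
import Data.Bool as Bool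
open import Data.Empty using (⊥-elim-irr)
open import Data.Fin using (Fin; zero; suc; toℕ; fromℕ<)
import Data.Fin as Fin
import Data.Fin.Properties as Fin
open import Data.Fin.Subset using (Subset; inside; outside; _∈_; _∉_; _⊆_; _∪_; _∩_; _-_; ⁅_⁆; ∣_∣)
open import Data.Fin.Subset.Properties
open import Data.Nat using (zero; suc; s≤s)
import Data.Nat as ℕ
open import Data.Nat.DivMod using
  (_mod_; _%_; _/_; m%n<n; m%n%n≡m%n; m<n⇒m%n≡m; %-distribˡ-+; [m+n]%n≡m%n; m≡m%n+[m/n]*n)
import Data.Nat.Properties as ℕ
open import Data.List using (allFin; deduplicate)
import Data.List.Properties as List
open import Data.Product using (_×_; _,_; proj₁; proj₂; ∃-syntax)
import Data.Sum as Sum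
open import Data.Sum using (_⊎_; inj₁; inj₂)
open import Data.Unit using (tt)
open import Data.Vec using (_∷_; here; there)
import Data.Vec as Vec
open import Data.Vec.Properties using (lookup∘tabulate; tabulate-cong; lookup⇒[]=; []=⇒lookup; ≡-dec)
open import Relation.Binary.Definitions using (tri<; tri≈; tri>)
open import Relation.Binary.PropositionalEquality as ≡ using (_≡_; _≢_; refl; cong)
import Relation.Binary.Reasoning.Setoid as SetoidReasoning
open import Relation.Binary.Construct.Closure.ReflexiveTransitive as Star using (ε; _◅_; _◅◅_)
open import Function.Bundles using (_⇔_; mk⇔; Equivalence)
open import Relation.Nullary using (Dec; yes; no; does; ¬_; contradiction)
open import Relation.Nullary.Decidable using (map′; _×-dec_; ¬?; _→-dec_; dec-true; dec-false; does-⇔)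

-- Acyclicity is proved by induction along the edge order. For j from 0 to m, consider the cochains
-- that vanish on every set unbroken below j; they form a subcomplex because those sets are closed
-- under subsets. It is zero for j = 0 and the kernel of the restriction to NBC for j = m. Passing
-- from j to j + 1 admits just the sets first broken at edge number j, and these pair off by
-- toggling that one edge, along isomorphisms. Cochains are defined by cases on brokenness, hence
-- the finite search that decides it.

-- Signs and finite sums.

module SignRule (R : CommutativeRing 0ℓ 0ℓ) where

  open CommutativeRing R renaming (refl to ≈-refl; sym to ≈-sym; trans to ≈-trans)
  open Exponentiation semiring using (_^_)
  open RingProperties ring using (-‿distribˡ-*; -‿distribʳ-*; -1*x≈-x)
  open AbelianGroupProperties +-abelianGroup using (⁻¹-involutive)
  open SetoidReasoning setoid

  -1^ : ℕ → Carrier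
  -1^ k = (- 1#) ^ k

  -1^-suc : ∀ k → -1^ (suc k) ≈ - (-1^ k)
  -1^-suc k = -1*x≈-x (-1^ k)

  -1^-square : ∀ k → -1^ k * -1^ k ≈ 1#
  -1^-square zero    = *-identityˡ 1#
  -1^-square (suc k) = begin
    -1^ (suc k) * -1^ (suc k)   ≈⟨ *-cong (-1^-suc k) (-1^-suc k) ⟩
    - (-1^ k) * - (-1^ k)       ≈⟨ -‿distribˡ-* (-1^ k) (- (-1^ k)) ⟨
    - (-1^ k * - (-1^ k))       ≈⟨ -‿cong (-‿distribʳ-* (-1^ k) (-1^ k)) ⟨
    - - (-1^ k * -1^ k)         ≈⟨ ⁻¹-involutive (-1^ k * -1^ k) ⟩
    -1^ k * -1^ k               ≈⟨ -1^-square k ⟩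
    1#                          ∎

  -- Models the two ways of removing i < j from a set: the count of edges below i ignores j, while
  -- the count below j drops by one once i is gone.
  -1^-anticommute : ∀ {a b a′ b′} → a′ ≡ a → b′ ≡ suc b →
                    -1^ a * -1^ b + -1^ b′ * -1^ a′ ≈ 0#
  -1^-anticommute {a} {b} refl refl = begin
    -1^ a * -1^ b + -1^ (suc b) * -1^ a       ≈⟨ +-congˡ (*-congʳ (-1^-suc b)) ⟩
    -1^ a * -1^ b + - (-1^ b) * -1^ a         ≈⟨ +-congˡ (-‿distribˡ-* (-1^ b) (-1^ a)) ⟨
    -1^ a * -1^ b + - (-1^ b * -1^ a)         ≈⟨ +-congˡ (-‿cong (*-comm (-1^ b) (-1^ a))) ⟩
    -1^ a * -1^ b + - (-1^ a * -1^ b)         ≈⟨ -‿inverseʳ (-1^ a * -1^ b) ⟩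
    0#                                        ∎

module FiniteSums (M : CommutativeMonoid 0ℓ 0ℓ) where

  open CommutativeMonoid M renaming (_∙_ to _+_; ε to 0#; refl to ≈-refl; sym to ≈-sym; trans to ≈-trans)
  open Sums M public using (sum; sum-cong-≋; sum-replicate-zero; ∑-distrib-+)

  sum-zero : ∀ {k} (t : Fin k → Carrier) → (∀ i → t i ≈ 0#) → sum t ≈ 0#
  sum-zero {k} t t≈0 = ≈-trans (sum-cong-≋ t≈0) (sum-replicate-zero k)

  sum-single : ∀ {k} (t : Fin k → Carrier) e → (∀ i → i ≢ e → t i ≈ 0#) → sum t ≈ t e
  sum-single t zero    h = ≈-trans (∙-congˡ (sum-zero _ λ i → h (suc i) λ ())) (identityʳ _)
  sum-single t (suc e) h = ≈-trans (∙-congʳ (h zero λ ()))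
    (≈-trans (identityˡ _) (sum-single _ e λ i i≢e → h (suc i) λ eq → i≢e (Fin.suc-injective eq)))

  -- The first row cancels against the first column, entry by entry, and induction handles the
  -- remaining square. The diagonal has its own hypothesis since x + x = 0 would not give x = 0.
  sum-antisymmetric : ∀ {k} (a : Fin k → Fin k → Carrier) → (∀ i → a i i ≈ 0#) →
                      (∀ i j → i ≢ j → a i j + a j i ≈ 0#) → sum (λ i → sum (a i)) ≈ 0#
  sum-antisymmetric {zero}  a diag anti = ≈-refl
  sum-antisymmetric {suc k} a diag anti = begin
    (a zero zero + sum row) + sum (λ i → col i + sum (λ j → a (suc i) (suc j)))
      ≈⟨ ∙-cong (∙-congʳ (diag zero)) (∑-distrib-+ col _) ⟩
    (0# + sum row) + (sum col + sum (λ i → sum (λ j → a (suc i) (suc j))))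
      ≈⟨ ∙-cong (identityˡ _) (≈-trans (∙-congˡ inner) (identityʳ _)) ⟩
    sum row + sum col
      ≈⟨ ∑-distrib-+ row col ⟨
    sum (λ i → row i + col i)
      ≈⟨ sum-zero _ (λ i → anti zero (suc i) λ ()) ⟩
    0# ∎
    where
    open SetoidReasoning setoid
    row = λ j → a zero (suc j)
    col = λ i → a (suc i) zero
    inner = sum-antisymmetric (λ i j → a (suc i) (suc j)) (λ i → diag (suc i))
              (λ i j i≢j → anti (suc i) (suc j) λ eq → i≢j (Fin.suc-injective eq))

-- Adding and removing an element of a finite subset.

module _ {n : ℕ} where

  ∈-remove⇒≢ : ∀ {p : Subset n} {x y} → x ∈ p - y → x ≢ y
  ∈-remove⇒≢ {p} {x} x∈ refl = x∉p-x p x x∈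
    where
    x∉p-x : ∀ {n} (p : Subset n) x → x ∉ p - x
    x∉p-x (_ ∷ p) (suc x) (there x∈) = x∉p-x p x x∈

  ∈-remove⇒∈ : ∀ {p : Subset n} {x y} → x ∈ p - y → x ∈ p
  ∈-remove⇒∈ {p} {y = y} = p─q⊆p p ⁅ y ⁆

  remove-insert⊆ : ∀ {p : Subset n} {x} → (p ∪ ⁅ x ⁆) - x ⊆ p
  remove-insert⊆ {p} {x} y∈ with x∈p∪q⁻ p ⁅ x ⁆ (∈-remove⇒∈ y∈)
  ... | inj₁ y∈p = y∈p
  ... | inj₂ y∈x = contradiction (x∈⁅y⁆⇒x≡y x y∈x) (∈-remove⇒≢ y∈)

  insert-remove : ∀ {p : Subset n} {x} → x ∈ p → (p - x) ∪ ⁅ x ⁆ ≡ p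
  insert-remove {p} {x} x∈p = ⊆-antisym ⊆₁ ⊆₂
    where
    ⊆₁ : (p - x) ∪ ⁅ x ⁆ ⊆ p
    ⊆₁ y∈ with x∈p∪q⁻ (p - x) ⁅ x ⁆ y∈
    ... | inj₁ y∈p-x = ∈-remove⇒∈ y∈p-x
    ... | inj₂ y∈x rewrite x∈⁅y⁆⇒x≡y x y∈x = x∈p
    ⊆₂ : p ⊆ (p - x) ∪ ⁅ x ⁆
    ⊆₂ {y} y∈ with y Fin.≟ x
    ... | yes refl = q⊆p∪q (p - x) ⁅ x ⁆ (x∈⁅x⁆ x)
    ... | no y≢x   = p⊆p∪q ⁅ x ⁆ (x∈p∧x≢y⇒x∈p-y y∈ y≢x)

  remove-insert : ∀ {p : Subset n} {x} → x ∉ p → (p ∪ ⁅ x ⁆) - x ≡ p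
  remove-insert {p} {x} x∉p = ⊆-antisym remove-insert⊆
    λ y∈ → x∈p∧x≢y⇒x∈p-y (p⊆p∪q ⁅ x ⁆ y∈) λ where refl → x∉p y∈

∣p∪⁅x⁆∣ : ∀ {n k} {p : Subset n} {x} → x ∉ p → ∣ p ∣ ≡ k → ∣ p ∪ ⁅ x ⁆ ∣ ≡ suc k
∣p∪⁅x⁆∣ {p = inside ∷ p}  {zero}  x∉ refl = contradiction here x∉
∣p∪⁅x⁆∣ {p = outside ∷ p} {zero}  x∉ refl = cong suc (cong ∣_∣ (∪-identityʳ p))
∣p∪⁅x⁆∣ {p = inside ∷ p}  {suc x} x∉ refl = cong suc (∣p∪⁅x⁆∣ {p = p} (λ x∈ → x∉ (there x∈)) refl)
∣p∪⁅x⁆∣ {p = outside ∷ p} {suc x} x∉ refl = ∣p∪⁅x⁆∣ {p = p} (λ x∈ → x∉ (there x∈)) refl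

remove-∩ : ∀ {n} (p q : Subset n) x → (p - x) ∩ q ≡ (p ∩ q) - x
remove-∩ p q x = ⊆-antisym
  (λ y∈ → let (y∈p-x , y∈q) = x∈p∩q⁻ (p - x) q y∈ in
    x∈p∧x≢y⇒x∈p-y (x∈p∩q⁺ (∈-remove⇒∈ y∈p-x , y∈q)) (∈-remove⇒≢ y∈p-x))
  (λ y∈ → let (y∈p , y∈q) = x∈p∩q⁻ p q (∈-remove⇒∈ y∈) in
    x∈p∩q⁺ (x∈p∧x≢y⇒x∈p-y y∈p (∈-remove⇒≢ y∈) , y∈q))

remove-∉ : ∀ {n} {p : Subset n} {x} → x ∉ p → p - x ≡ p
remove-∉ {p = p} {x} x∉p = ⊆-antisym ∈-remove⇒∈ λ y∈ → x∈p∧x≢y⇒x∈p-y y∈ λ where refl → x∉p y∈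

∣remove∣ : ∀ {n} {p : Subset n} {x} → x ∈ p → ∣ p ∣ ≡ suc ∣ p - x ∣
∣remove∣ {p = p} {x} x∈p = ≡.trans (cong ∣_∣ (≡.sym (insert-remove x∈p)))
  (∣p∪⁅x⁆∣ (λ x∈ → ∈-remove⇒≢ {p = p} x∈ refl) refl)

-- `P j` is meant to speak of the edges below j, so a step is asked for only where j is the number
-- of an edge.
initial-induction : ∀ {m} (P : ℕ → Set) → P 0 → (∀ (e : Fin m) → P (toℕ e) → P (suc (toℕ e))) → P m
initial-induction {zero}  P base step = base
initial-induction {suc m} P base step =
  initial-induction (λ j → P (suc j)) (step zero base) (λ e → step (suc e))

module _ (K : CommutativeRing 0ℓ 0ℓ) where

  open Representations K

  -- Bijective homomorphisms of representations.

  module _ {G : Group 0ℓ 0ℓ} where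

    -- Surjectivity carries a chosen preimage of each element. The choice need not respect equality
    -- a priori; injectivity makes it a homomorphism.
    Bijective : {V W : Rep G} → V ⇒ W → Set
    Bijective {V} {W} f =
      (∀ {x} → to f x W.≈ᴹ W.0ᴹ → x V.≈ᴹ V.0ᴹ) × (∀ y → ∃[ x ] to f x W.≈ᴹ y)
      where
      module V = Rep V
      module W = Rep W

    bijective-≗ : {V W : Rep G} {f g : V ⇒ W} → f ≗ g → Bijective g → Bijective f
    bijective-≗ {W = W} f≗g (inj , surj) =
      (λ {x} fx≈0 → inj (W.≈ᴹ-trans (W.≈ᴹ-sym (f≗g x)) fx≈0)) ,
      λ y → let (x , gx≈y) = surj y in x , W.≈ᴹ-trans (f≗g x) gx≈y
      where module W = Rep W

    module _ {V W : Rep G} (f : V ⇒ W) where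

      private
        module V = Rep V
        module W = Rep W
        module f = _⇒_ f
        module VP = AbelianGroupProperties V.+ᴹ-abelianGroup

      module BijectiveInverse (bij : Bijective f) where

        injective : ∀ {x y} → f.to x W.≈ᴹ f.to y → x V.≈ᴹ y
        injective {x} {y} fx≈fy = VP.x∙y⁻¹≈ε⇒x≈y x y (proj₁ bij
          (W.≈ᴹ-trans (f.to-+ x (V.-ᴹ y))
          (W.≈ᴹ-trans (W.+ᴹ-cong fx≈fy (f.to-neg y)) (W.-ᴹ‿inverseʳ (f.to y)))))

        preimage : ∣ W ∣ᴿ → ∣ V ∣ᴿ
        preimage y = proj₁ (proj₂ bij y)

        to-preimage : ∀ y → f.to (preimage y) W.≈ᴹ y
        to-preimage y = proj₂ (proj₂ bij y)

        inverse : W ⇒ V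
        inverse = record
          { to = preimage
          ; isLinear = linear W V preimage
              (λ {x} {y} x≈y → injective (W.≈ᴹ-trans (to-preimage x) (W.≈ᴹ-trans x≈y (W.≈ᴹ-sym (to-preimage y)))))
              (λ x y → injective (W.≈ᴹ-trans (to-preimage (x W.+ᴹ y)) (W.≈ᴹ-sym
                (W.≈ᴹ-trans (f.to-+ (preimage x) (preimage y)) (W.+ᴹ-cong (to-preimage x) (to-preimage y))))))
              (λ r x → injective (W.≈ᴹ-trans (to-preimage (r W.*ₗ x)) (W.≈ᴹ-sym
                (W.≈ᴹ-trans (f.to-* r (preimage x)) (W.*ₗ-congˡ (to-preimage x))))))
          ; to-· = λ g x → injective (W.≈ᴹ-trans (to-preimage (g W.· x)) (W.≈ᴹ-sym
                (W.≈ᴹ-trans (f.to-· g (preimage x)) (W.·-cong (Group.refl G) (to-preimage x))))) }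

    bijective⇒≅ᵍ : {V W : GradedRep G} (f : V ⇒ᵍ W) → (∀ d → Bijective (f d)) → V ≅ᵍ W
    bijective⇒≅ᵍ f bij = record
      { forward          = f
      ; backward         = λ d → I.inverse d
      ; backward∘forward = λ d x → I.injective d (I.to-preimage d (to (f d) x))
      ; forward∘backward = λ d → I.to-preimage d }
      where module I d = BijectiveInverse (f d) (bij d)

    module _ {V W : Rep G} where

      private
        module W = Rep W
        module WS = FiniteSums W.+ᴹ-commutativeMonoid

      sumᴿ-sum : ∀ {k} (f : Fin k → V ⇒ W) x → to (sumᴿ f) x W.≈ᴹ WS.sum (λ i → to (f i) x)
      sumᴿ-sum {zero}  f x = W.≈ᴹ-refl
      sumᴿ-sum {suc k} f x = W.+ᴹ-cong W.≈ᴹ-refl (sumᴿ-sum (λ i → f (suc i)) x)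

      to-sum : ∀ {k} (f : V ⇒ W) (t : Fin k → ∣ V ∣ᴿ) →
               to f (FiniteSums.sum (Rep.+ᴹ-commutativeMonoid V) t) W.≈ᴹ WS.sum (λ i → to f (t i))
      to-sum {zero}  f t = _⇒_.to-0 f
      to-sum {suc k} f t = W.≈ᴹ-trans (_⇒_.to-+ f _ _) (W.+ᴹ-cong W.≈ᴹ-refl (to-sum f (λ i → t (suc i))))

  -- The differential and its square.

  module _ {m : ℕ} {G : Group 0ℓ 0ℓ} (F : BooleanFunctor m G) (Q : LowerIdeal m) where

    open BooleanFunctor F
    open Cohomology F Q

    private
      module K = CommutativeRing K
      module S = SignRule K
      module F₀ S d = Rep (F₀ S d)
      module ∑ S d = FiniteSums (Rep.+ᴹ-commutativeMonoid (F₀ S d))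

      module _ (i : Fin m) where

        below : Subset m
        below = Vec.tabulate λ j → does (j Fin.<? i)

        <⇒∈-below : ∀ {j} → j Fin.< i → j ∈ below
        <⇒∈-below {j} j<i = lookup⇒[]= j below (≡.trans (lookup∘tabulate _ j) (dec-true (j Fin.<? i) j<i))

        ≮⇒∉-below : ∀ {j} → ¬ j Fin.< i → j ∉ below
        ≮⇒∉-below {j} j≮i j∈ with ≡.trans (≡.sym ([]=⇒lookup j∈))
                                   (≡.trans (lookup∘tabulate _ j) (dec-false (j Fin.<? i) j≮i))
        ... | ()

        #below-remove-< : ∀ {j} T → j ∈ T → j Fin.< i → #below i T ≡ suc (#below i (T - j))
        #below-remove-< {j} T j∈T j<i = ≡.trans (∣remove∣ (x∈p∩q⁺ (j∈T , <⇒∈-below j<i)))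
          (cong (λ p → suc ∣ p ∣) (≡.sym (remove-∩ T below j)))

        #below-remove-≮ : ∀ {j} T → ¬ j Fin.< i → #below i (T - j) ≡ #below i T
        #below-remove-≮ {j} T j≮i = cong ∣_∣ (≡.trans (remove-∩ T below j)
          (remove-∉ λ j∈ → ≮⇒∉-below j≮i (proj₂ (x∈p∩q⁻ T below j∈))))

    sign-square : ∀ (V : Rep G) i S v → Rep._≈ᴹ_ V (Rep._*ₗ_ V (sign i S) (Rep._*ₗ_ V (sign i S) v)) v
    sign-square V i S v = V.≈ᴹ-trans (V.≈ᴹ-sym (V.*ₗ-assoc (sign i S) (sign i S) v))
      (V.≈ᴹ-trans (V.*ₗ-congʳ (S.-1^-square (#below i S))) (V.*ₗ-identityˡ v))
      where module V = Rep V

    -- Sets such as (T - e) ∪ {e} and T agree only propositionally, so the values of `x` there have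
    -- different types. `F₁` along the equality serves as transport.
    F₁-cell : ∀ {k} d (x : ∣ C k d ∣ᴿ) (T T′ : Cell k) .(p : set T ⊆ set T′) → set T ≡ set T′ →
              F₀._≈ᴹ_ (set T′) d (to (F₁ p d) (x T)) (x T′)
    F₁-cell d x (cell S _ _) (cell .S _ _) p refl = identity d (x _)

    module _ {k} d (T : Cell (suc k)) (x : ∣ C k d ∣ᴿ) where

      private module V = F₀ (set T) d

      face-yes : ∀ i (dec : Dec (i ∈ set T)) (i∈T : i ∈ set T) → to (face d T i dec) x V.≈ᴹ
                 sign i (set T - i) V.*ₗ to (F₁ (p─q⊆p (set T) ⁅ i ⁆) d) (x (remove T i i∈T))
      face-yes i (yes _)  i∈T = V.≈ᴹ-refl
      face-yes i (no i∉T) i∈T = contradiction i∈T i∉T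

      face-zero : ∀ i (dec : Dec (i ∈ set T)) →
                  ((i∈T : i ∈ set T) → F₀._≈ᴹ_ (set T - i) d (x (remove T i i∈T)) (F₀.0ᴹ (set T - i) d)) →
                  to (face d T i dec) x V.≈ᴹ V.0ᴹ
      face-zero i (no _)    x≈0 = V.≈ᴹ-refl
      face-zero i (yes i∈T) x≈0 = V.≈ᴹ-trans (V.*ₗ-congˡ (V.≈ᴹ-trans
        (_⇒_.to-cong (F₁ _ d) (x≈0 i∈T)) (_⇒_.to-0 (F₁ _ d)))) (V.*ₗ-zeroʳ _)

      δ-sum : to (δ k d) x T V.≈ᴹ ∑.sum (set T) d (λ i → to (face d T i (i ∈? set T)) x)
      δ-sum = sumᴿ-sum (λ i → face d T i (i ∈? set T)) x

      δ-zero : (∀ i (i∈T : i ∈ set T) → F₀._≈ᴹ_ (set T - i) d (x (remove T i i∈T)) (F₀.0ᴹ (set T - i) d)) →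
               to (δ k d) x T V.≈ᴹ V.0ᴹ
      δ-zero x≈0 = V.≈ᴹ-trans δ-sum (∑.sum-zero (set T) d _ λ i → face-zero i (i ∈? set T) (x≈0 i))

      -- Isolates one value of `x`, which can then be recovered from δ x when the remaining morphism
      -- is invertible.
      δ-single : ∀ e (e∈T : e ∈ set T) →
        (∀ i → i ≢ e → (i∈T : i ∈ set T) →
          F₀._≈ᴹ_ (set T - i) d (x (remove T i i∈T)) (F₀.0ᴹ (set T - i) d)) →
        to (δ k d) x T V.≈ᴹ sign e (set T - e) V.*ₗ to (F₁ (p─q⊆p (set T) ⁅ e ⁆) d) (x (remove T e e∈T))
      δ-single e e∈T x≈0 = V.≈ᴹ-trans δ-sum (V.≈ᴹ-trans
        (∑.sum-single (set T) d _ e λ i i≢e → face-zero i (i ∈? set T) (x≈0 i i≢e))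
        (face-yes e (e ∈? set T) e∈T))

    module _ {k} d (T : Cell (suc (suc k))) (x : ∣ C k d ∣ᴿ) where

      private
        module V = F₀ (set T) d

        faces : Fin m → ∣ C (suc k) d ∣ᴿ
        faces j T′ = to (face d T′ j (j ∈? set T′)) x

        -- The term of the double sum for δ (δ x) at T in which T loses i and then j.
        a : Fin m → Fin m → ∣ F₀ (set T) d ∣ᴿ
        a i j = to (face d T i (i ∈? set T)) (faces j)

        a-zero : ∀ i j → ¬ (i ∈ set T × j ∈ set T - i) → a i j V.≈ᴹ V.0ᴹ
        a-zero i j ∉T = face-zero d T (faces j) i (i ∈? set T) λ i∈T →
          face-zero d (remove T i i∈T) x j (j ∈? (set T - i)) λ j∈T-i → contradiction (i∈T , j∈T-i) ∉T

        a-value : ∀ i j (i∈T : i ∈ set T) (j∈T-i : j ∈ set T - i) → a i j V.≈ᴹ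
          (sign i (set T - i) K.* sign j (set T - i - j)) V.*ₗ
          to (F₁ (⊆-trans (p─q⊆p (set T - i) ⁅ j ⁆) (p─q⊆p (set T) ⁅ i ⁆)) d)
             (x (remove (remove T i i∈T) j j∈T-i))
        a-value i j i∈T j∈T-i = begin
          a i j
            ≈⟨ face-yes d T (faces j) i (i ∈? set T) i∈T ⟩
          s V.*ₗ to (F₁ outer d) (faces j (remove T i i∈T))
            ≈⟨ V.*ₗ-congˡ (_⇒_.to-cong (F₁ outer d)
                 (face-yes d (remove T i i∈T) x j (j ∈? (set T - i)) j∈T-i)) ⟩
          s V.*ₗ to (F₁ outer d) (F₀._*ₗ_ (set T - i) d s′ (to (F₁ inner d) x′))
            ≈⟨ V.*ₗ-congˡ (_⇒_.to-* (F₁ outer d) s′ _) ⟩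
          s V.*ₗ (s′ V.*ₗ to (F₁ outer d) (to (F₁ inner d) x′))
            ≈⟨ V.*ₗ-assoc s s′ _ ⟨
          (s K.* s′) V.*ₗ to (F₁ outer d) (to (F₁ inner d) x′)
            ≈⟨ V.*ₗ-congˡ (homomorphism inner outer d x′) ⟨
          (s K.* s′) V.*ₗ to (F₁ (⊆-trans inner outer) d) x′ ∎
          where
          open SetoidReasoning V.≈ᴹ-setoid
          s = sign i (set T - i)
          s′ = sign j (set T - i - j)
          inner : set T - i - j ⊆ set T - i
          inner = p─q⊆p (set T - i) ⁅ j ⁆
          outer : set T - i ⊆ set T
          outer = p─q⊆p (set T) ⁅ i ⁆
          x′ = x (remove (remove T i i∈T) j j∈T-i)

        -- By functoriality both orders of removal transport the same value to T. Removing i changes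
        -- the number of edges below j by one and removing j leaves the number below i alone, so the
        -- signs are opposite.
        a-anti< : ∀ i j → i ∈ set T → j ∈ set T → i Fin.< j → (a i j V.+ᴹ a j i) V.≈ᴹ V.0ᴹ
        a-anti< i j i∈T j∈T i<j = begin
          a i j V.+ᴹ a j i
            ≈⟨ V.+ᴹ-cong (a-value i j i∈T j∈T-i) (a-value j i j∈T i∈T-j) ⟩
          (S.-1^ p K.* S.-1^ q) V.*ₗ to (F₁ ij⊆T d) xij V.+ᴹ (S.-1^ q′ K.* S.-1^ p′) V.*ₗ v
            ≈⟨ V.+ᴹ-cong (V.*ₗ-congˡ swapped) V.≈ᴹ-refl ⟩
          (S.-1^ p K.* S.-1^ q) V.*ₗ v V.+ᴹ (S.-1^ q′ K.* S.-1^ p′) V.*ₗ v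
            ≈⟨ V.*ₗ-distribʳ v (S.-1^ p K.* S.-1^ q) (S.-1^ q′ K.* S.-1^ p′) ⟨
          (S.-1^ p K.* S.-1^ q K.+ S.-1^ q′ K.* S.-1^ p′) V.*ₗ v
            ≈⟨ V.*ₗ-congʳ (S.-1^-anticommute p′≡ q′≡) ⟩
          K.0# V.*ₗ v
            ≈⟨ V.*ₗ-zeroˡ v ⟩
          V.0ᴹ ∎
          where
          open SetoidReasoning V.≈ᴹ-setoid
          j∈T-i = x∈p∧x≢y⇒x∈p-y j∈T λ j≡i → Fin.<⇒≢ i<j (≡.sym j≡i)
          i∈T-j = x∈p∧x≢y⇒x∈p-y i∈T (Fin.<⇒≢ i<j)
          ij⊆T : set T - i - j ⊆ set T
          ij⊆T = ⊆-trans (p─q⊆p (set T - i) ⁅ j ⁆) (p─q⊆p (set T) ⁅ i ⁆)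
          ji⊆T : set T - j - i ⊆ set T
          ji⊆T = ⊆-trans (p─q⊆p (set T - j) ⁅ i ⁆) (p─q⊆p (set T) ⁅ j ⁆)
          Tij Tji : Cell k
          Tij = remove (remove T i i∈T) j j∈T-i
          Tji = remove (remove T j j∈T) i i∈T-j
          ij≡ji : set T - i - j ≡ set T - j - i
          ij≡ji = p─x─y≡p─y─x (set T) i j
          xij = x Tij
          v = to (F₁ ji⊆T d) (x Tji)
          p = #below i (set T - i)
          p′ = #below i (set T - j - i)
          q = #below j (set T - i - j)
          q′ = #below j (set T - j)
          p′≡ : p′ ≡ p
          p′≡ = ≡.trans (cong (#below i) (≡.sym ij≡ji)) (#below-remove-≮ i (set T - i) (Fin.<-asym i<j))
          q′≡ : q′ ≡ suc q
          q′≡ = ≡.trans (#below-remove-< j (set T - j) i∈T-j i<j) (cong (λ S → suc (#below j S)) (≡.sym ij≡ji))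
          swapped : to (F₁ ij⊆T d) xij V.≈ᴹ v
          swapped = V.≈ᴹ-trans (homomorphism (⊆-reflexive ij≡ji) ji⊆T d xij)
            (_⇒_.to-cong (F₁ ji⊆T d) (F₁-cell d x Tij Tji (⊆-reflexive ij≡ji) ij≡ji))

        a-anti : ∀ i j → i ≢ j → (a i j V.+ᴹ a j i) V.≈ᴹ V.0ᴹ
        a-anti i j i≢j with i ∈? set T ×-dec j ∈? set T
        ... | no ∉T = V.≈ᴹ-trans (V.+ᴹ-cong
                (a-zero i j λ (i∈T , j∈T-i) → ∉T (i∈T , ∈-remove⇒∈ j∈T-i))
                (a-zero j i λ (j∈T , i∈T-j) → ∉T (∈-remove⇒∈ i∈T-j , j∈T))) (V.+ᴹ-identityˡ V.0ᴹ)
        ... | yes (i∈T , j∈T) with Fin.<-cmp i j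
        ... | tri< i<j _ _ = a-anti< i j i∈T j∈T i<j
        ... | tri≈ _ i≡j _ = contradiction i≡j i≢j
        ... | tri> _ _ j<i = V.≈ᴹ-trans (V.+ᴹ-comm (a i j) (a j i)) (a-anti< j i j∈T i∈T j<i)

      δ∘δ : to (δ (suc k) d) (to (δ k d) x) T V.≈ᴹ V.0ᴹ
      δ∘δ = begin
        to (δ (suc k) d) (to (δ k d) x) T
          ≈⟨ δ-sum d T (to (δ k d) x) ⟩
        ∑.sum (set T) d (λ i → to (face d T i (i ∈? set T)) (to (δ k d) x))
          ≈⟨ ∑.sum-cong-≋ (set T) d (λ i → V.≈ᴹ-trans
               (_⇒_.to-cong (face d T i (i ∈? set T)) δx≈) (to-sum (face d T i (i ∈? set T)) faces)) ⟩
        ∑.sum (set T) d (λ i → ∑.sum (set T) d (a i))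
          ≈⟨ ∑.sum-antisymmetric (set T) d a
               (λ i → a-zero i i λ (_ , i∈T-i) → ∈-remove⇒≢ {p = set T} i∈T-i refl) a-anti ⟩
        V.0ᴹ ∎
        where
        open SetoidReasoning V.≈ᴹ-setoid
        module Cᵏ = Rep (C (suc k) d)
        -- An equality of whole cochains: the outer face is a homomorphism on cochains and
        -- distributes over the sum only in this form.
        δx≈ : to (δ k d) x Cᵏ.≈ᴹ FiniteSums.sum Cᵏ.+ᴹ-commutativeMonoid faces
        δx≈ T′ = F₀.≈ᴹ-trans (set T′) d (δ-sum d T′ x)
          (F₀.≈ᴹ-sym (set T′) d (to-sum (proj (λ T″ → F₀ (set T″) d) T′) faces))

  -- Maps induced on cohomology.

  record CochainMap {G : Group 0ℓ 0ℓ} {A B C A′ B′ C′ : Rep G}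
                    (f : A ⇒ B) (g : B ⇒ C) (f′ : A′ ⇒ B′) (g′ : B′ ⇒ C′) : Set where
    field
      α        : A ⇒ A′
      β        : B ⇒ B′
      γ        : C ⇒ C′
      square-f : (β ∘ᴿ f) ≗ (f′ ∘ᴿ α)
      square-g : (γ ∘ᴿ g) ≗ (g′ ∘ᴿ β)

  module _ {G : Group 0ℓ 0ℓ} {A B C A′ B′ C′ : Rep G} {f : A ⇒ B} {g : B ⇒ C} {f′ : A′ ⇒ B′} {g′ : B′ ⇒ C′}
           (φ : CochainMap f g f′ g′) where

    open CochainMap φ
    private
      module B = Rep B
      module B′ = Rep B′
      module C′ = Rep C′
      module H = Rep (ker/im f g)
      module H′ = Rep (ker/im f′ g′)

      pointwise : ∀ {x y : Cocycle f′ g′} → cochain x B′.≈ᴹ cochain y → x H′.≈ᴹ y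
      pointwise {y = y} x≈y = Rep.0ᴹ A′ , B′.≈ᴹ-trans x≈y (B′.≈ᴹ-sym
        (B′.≈ᴹ-trans (B′.+ᴹ-congˡ (_⇒_.to-0 f′)) (B′.+ᴹ-identityʳ (cochain y))))

      map : Cocycle f g → Cocycle f′ g′
      map x = to β (cochain x) , C′.≈ᴹ-trans (C′.≈ᴹ-sym (square-g (cochain x)))
                                    (C′.≈ᴹ-trans (_⇒_.to-cong γ (closed x)) (_⇒_.to-0 γ))

    induced : ker/im f g ⇒ ker/im f′ g′
    induced = record
      { to = map
      ; isLinear = linear (ker/im f g) (ker/im f′ g′) map
          (λ {x} {y} (a , p) → to α a , B′.≈ᴹ-trans (_⇒_.to-cong β p)
            (B′.≈ᴹ-trans (_⇒_.to-+ β (cochain y) (to f a)) (B′.+ᴹ-congˡ (square-f a))))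
          (λ x y → pointwise {map (x H.+ᴹ y)} {map x H′.+ᴹ map y} (_⇒_.to-+ β (cochain x) (cochain y)))
          (λ r x → pointwise {map (r H.*ₗ x)} {r H′.*ₗ map x} (_⇒_.to-* β r (cochain x)))
      ; to-· = λ h x → pointwise {map (h H.· x)} {h H′.· map x} (_⇒_.to-· β h (cochain x)) }

    -- The second hypothesis asks for a cocycle lifting y exactly, not up to a coboundary; such
    -- lifts exist when the map is onto in each degree with acyclic kernel.
    induced-bijective :
      (∀ x a′ → Rep._≈ᴹ_ C (to g x) (Rep.0ᴹ C) → to β x B′.≈ᴹ to f′ a′ → ∃[ a ] x B.≈ᴹ to f a) →
      (∀ y → to g′ y C′.≈ᴹ C′.0ᴹ → ∃[ x ] (Rep._≈ᴹ_ C (to g x) (Rep.0ᴹ C) × to β x B′.≈ᴹ y)) →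
      Bijective induced
    induced-bijective inj surj =
      (λ {x} (a′ , p) →
        let (a , q) = inj (cochain x) a′ (closed x) (B′.≈ᴹ-trans p (B′.+ᴹ-identityˡ _)) in
        a , B.≈ᴹ-trans q (B.≈ᴹ-sym (B.+ᴹ-identityˡ _))) ,
      λ y → let (x , gx≈0 , p) = surj (cochain y) (closed y) in (x , gx≈0) , pointwise p

  -- Acyclic matchings.

  -- Toggling the first e with Broken e S matches the sets that are broken somewhere.
  record Matching {m : ℕ} {G : Group 0ℓ 0ℓ} (F : BooleanFunctor m G) : Set₁ where
    open BooleanFunctor F
    field
      Broken    : Fin m → Subset m → Set
      broken?   : ∀ e S → Dec (Broken e S)
      monotone  : ∀ {e S T} → S ⊆ T → Broken e S → Broken e T
      local     : ∀ {e f S} → f Fin.≤ e → Broken f S → Broken f (S - e)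
      bijective : ∀ {e S} → e ∉ S → Broken e S → ∀ d → Bijective (F₁ {S} {S ∪ ⁅ e ⁆} (p⊆p∪q ⁅ e ⁆) d)

    -- Indexed by a number so that the induction runs from j = 0, where the condition is empty, to j
    -- = m, where for a graph it describes NBC.
    Unbroken : ℕ → Subset m → Set
    Unbroken j S = ∀ f → toℕ f ℕ.< j → ¬ Broken f S

    unbroken? : ∀ j S → Dec (Unbroken j S)
    unbroken? j S = Fin.all? λ f → (toℕ f ℕ.<? j) →-dec ¬? (broken? f S)

    unbroken-⊆ : ∀ {j S T} → S ⊆ T → Unbroken j T → Unbroken j S
    unbroken-⊆ S⊆T u f f<j b = u f f<j (monotone S⊆T b)

    -- A set broken at some f < e remains so when e is deleted, so inserting e cannot be what broke
    -- it.
    unbroken-insert : ∀ {e S} → Unbroken (toℕ e) S → Unbroken (toℕ e) (S ∪ ⁅ e ⁆)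
    unbroken-insert u f f<e b = u f f<e (monotone remove-insert⊆ (local (ℕ.<⇒≤ f<e) b))

    unbroken-suc : ∀ {e S} → Unbroken (toℕ e) S → ¬ Broken e S → Unbroken (suc (toℕ e)) S
    unbroken-suc {e} u ¬b f f≤e with ℕ.m<1+n⇒m<n∨m≡n f≤e
    ... | inj₁ f<e = u f f<e
    ... | inj₂ f≡e rewrite Fin.toℕ-injective f≡e = ¬b

  -- Exactness for cochains that vanish on unbroken sets.

  module _ {m : ℕ} {G : Group 0ℓ 0ℓ} (F : BooleanFunctor m G) (M : Matching F) where

    open BooleanFunctor F
    open Matching M
    open Cohomology F (2ᴱ {m})

    private
      module F₀ S d = Rep (F₀ S d)
      module Cᴿ k d = Rep (C k d)

    Vanishes : ∀ {k d} → ℕ → ∣ C k d ∣ᴿ → Set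
    Vanishes {d = d} j x = ∀ T → Unbroken j (set T) → F₀._≈ᴹ_ (set T) d (x T) (F₀.0ᴹ (set T) d)

    Closed : ∀ k d → ∣ C k d ∣ᴿ → Set
    Closed k d x = Cᴿ._≈ᴹ_ (suc k) d (to (δ k d) x) (Cᴿ.0ᴹ (suc k) d)

    closed-minus-coboundary : ∀ k d x (w : ∣ C k d ∣ᴿ) → Closed (suc k) d x →
      Closed (suc k) d (Cᴿ._+ᴹ_ (suc k) d x (Cᴿ.-ᴹ_ (suc k) d (to (δ k d) w)))
    closed-minus-coboundary k d x w x-closed = V.≈ᴹ-trans
      (_⇒_.to-+ (δ (suc k) d) x (Cᴿ.-ᴹ_ (suc k) d (to (δ k d) w)))
      (V.≈ᴹ-trans
        (V.+ᴹ-cong x-closed (V.≈ᴹ-trans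
          (_⇒_.to-neg (δ (suc k) d) (to (δ k d) w)) (V.-ᴹ‿cong (λ T → δ∘δ F 2ᴱ d T w))))
        (V.-ᴹ‿inverseʳ V.0ᴹ))
      where module V = Cᴿ (suc (suc k)) d

    module _ (e : Fin m) where

      insert : ∀ {k} (T : Cell k) → .(e ∉ set T) → Cell (suc k)
      insert (cell S _ ∣S∣) e∉S = cell (S ∪ ⁅ e ⁆) tt (∣p∪⁅x⁆∣ e∉S ∣S∣)

      -- At T ∪ {e}, closedness of u involves no value of u besides the one at T.
      vanishes-down : ∀ k d (u : ∣ C k d ∣ᴿ) → Closed k d u → Vanishes (suc (toℕ e)) u →
        (∀ T → Unbroken (toℕ e) (set T) → Broken e (set T) → e ∈ set T →
          F₀._≈ᴹ_ (set T) d (u T) (F₀.0ᴹ (set T) d)) →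
        Vanishes (toℕ e) u
      vanishes-down k d u closed van van-e T unb with broken? e (set T)
      ... | no ¬b = van T (unbroken-suc unb ¬b)
      ... | yes b with e ∈? set T
      ... | yes e∈T = van-e T unb b e∈T
      -- The morphism from T to U is injective, so it suffices that the image of `u T` is zero. Up
      -- to sign this image is all of δ u at U; multiplying by the sign twice removes it.
      ... | no  e∉T = proj₁ (bijective e∉T b d) (begin
        to (F₁ T⊆U d) (u T)
          ≈⟨ homomorphism T⊆U-e U-e⊆U d (u T) ⟩
        to (F₁ U-e⊆U d) (to (F₁ T⊆U-e d) (u T))
          ≈⟨ _⇒_.to-cong (F₁ U-e⊆U d) (F₁-cell F 2ᴱ d u T (remove U e e∈U) T⊆U-e (≡.sym U-e≡T)) ⟩
        to (F₁ U-e⊆U d) (u (remove U e e∈U))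
          ≈⟨ sign-square F 2ᴱ (F₀ (set U) d) e (set U - e) _ ⟨
        s V.*ₗ (s V.*ₗ to (F₁ U-e⊆U d) (u (remove U e e∈U)))
          ≈⟨ V.*ₗ-congˡ (δ-single F 2ᴱ d U u e e∈U others) ⟨
        s V.*ₗ to (δ k d) u U
          ≈⟨ V.*ₗ-congˡ (closed U) ⟩
        s V.*ₗ V.0ᴹ
          ≈⟨ V.*ₗ-zeroʳ s ⟩
        V.0ᴹ ∎)
        where
        U = insert T e∉T
        module V = F₀ (set U) d
        open SetoidReasoning V.≈ᴹ-setoid
        T⊆U : set T ⊆ set U
        T⊆U = p⊆p∪q ⁅ e ⁆
        e∈U : e ∈ set U
        e∈U = q⊆p∪q (set T) ⁅ e ⁆ (x∈⁅x⁆ e)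
        U-e≡T : set U - e ≡ set T
        U-e≡T = remove-insert e∉T
        T⊆U-e : set T ⊆ set U - e
        T⊆U-e = ⊆-reflexive (≡.sym U-e≡T)
        U-e⊆U : set U - e ⊆ set U
        U-e⊆U = p─q⊆p (set U) ⁅ e ⁆
        s = sign e (set U - e)
        others : ∀ i → i ≢ e → (i∈U : i ∈ set U) →
                 F₀._≈ᴹ_ (set U - i) d (u (remove U i i∈U)) (F₀.0ᴹ (set U - i) d)
        -- U - i still contains e and is unbroken below e. It falls under `van-e` if it is broken at
        -- e and under `van` otherwise.
        others i i≢e i∈U with broken? e (set U - i)
        ... | no ¬b  = van (remove U i i∈U) (unbroken-suc (unbroken-⊆ ∈-remove⇒∈ (unbroken-insert unb)) ¬b)
        ... | yes b′ = van-e (remove U i i∈U) (unbroken-⊆ ∈-remove⇒∈ (unbroken-insert unb)) b′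
                         (x∈p∧x≢y⇒x∈p-y e∈U λ e≡i → i≢e (≡.sym e≡i))

      -- The lower ends of the pairs matched by toggling e.
      Lower : Subset m → Set
      Lower S = Unbroken (toℕ e) S × Broken e S × e ∉ S

      lower? : ∀ S → Dec (Lower S)
      lower? S = unbroken? (toℕ e) S ×-dec broken? e S ×-dec ¬? (e ∈? S)

      module _ {k} d (x : ∣ C (suc k) d ∣ᴿ) where

        -- Pulls `x` back along the matched isomorphism. The sign is the one that δ attaches to T in
        -- T ∪ {e}, so that the two cancel.
        lowered : ∀ (T : Cell k) → Dec (Lower (set T)) → ∣ F₀ (set T) d ∣ᴿ
        lowered T (yes (_ , b , e∉T)) = F₀._*ₗ_ (set T) d (sign e (set T))
          (BijectiveInverse.preimage (F₁ (p⊆p∪q ⁅ e ⁆) d) (bijective e∉T b d) (x (insert T e∉T)))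
        lowered T (no _)              = F₀.0ᴹ (set T) d

        lowering : ∣ C k d ∣ᴿ
        lowering T = lowered T (lower? (set T))

        lowered-zero : ∀ T dec → ¬ Lower (set T) → F₀._≈ᴹ_ (set T) d (lowered T dec) (F₀.0ᴹ (set T) d)
        lowered-zero T (yes l) ¬l = contradiction l ¬l
        lowered-zero T (no _)  ¬l = F₀.≈ᴹ-refl (set T) d

        -- The target S is a variable because `δ-lowering` needs it to be a set that equals T ∪ {e}
        -- only propositionally.
        F₁-lowered : ∀ {S} T dec (e∉T : e ∉ set T) → Lower (set T) → (p : set T ∪ ⁅ e ⁆ ⊆ S) →
          F₀._≈ᴹ_ S d (F₀._*ₗ_ S d (sign e (set T)) (to (F₁ (⊆-trans (p⊆p∪q ⁅ e ⁆) p) d) (lowered T dec)))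
                      (to (F₁ p d) (x (insert T e∉T)))
        F₁-lowered T (no ¬l) e∉T l p = contradiction l ¬l
        F₁-lowered {S} T (yes (_ , b , e∉T)) _ l p = begin
          s V.*ₗ to (F₁ (⊆-trans (p⊆p∪q ⁅ e ⁆) p) d) (F₀._*ₗ_ (set T) d s y)
            ≈⟨ V.*ₗ-congˡ (_⇒_.to-* (F₁ (⊆-trans (p⊆p∪q ⁅ e ⁆) p) d) s y) ⟩
          s V.*ₗ (s V.*ₗ to (F₁ (⊆-trans (p⊆p∪q ⁅ e ⁆) p) d) y)
            ≈⟨ sign-square F 2ᴱ (F₀ S d) e (set T) _ ⟩
          to (F₁ (⊆-trans (p⊆p∪q ⁅ e ⁆) p) d) y
            ≈⟨ homomorphism (p⊆p∪q ⁅ e ⁆) p d y ⟩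
          to (F₁ p d) (to (F₁ (p⊆p∪q ⁅ e ⁆) d) y)
            ≈⟨ _⇒_.to-cong (F₁ p d)
                 (BijectiveInverse.to-preimage (F₁ (p⊆p∪q ⁅ e ⁆) d) (bijective e∉T b d) (x (insert T e∉T))) ⟩
          to (F₁ p d) (x (insert T e∉T)) ∎
          where
          module V = F₀ S d
          open SetoidReasoning V.≈ᴹ-setoid
          s = sign e (set T)
          y = BijectiveInverse.preimage (F₁ (p⊆p∪q ⁅ e ⁆) d) (bijective e∉T b d) (x (insert T e∉T))

        lowering-vanishes : Vanishes (suc (toℕ e)) lowering
        lowering-vanishes T unb = lowered-zero T (lower? (set T)) λ (_ , b , _) → unb e (ℕ.n<1+n (toℕ e)) b

        -- A facet T - i with i ≢ e contains e, hence is no lower end, so only the facet T - e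
        -- contributes.
        δ-lowering : ∀ T → Unbroken (toℕ e) (set T) → Broken e (set T) → e ∈ set T →
                     F₀._≈ᴹ_ (set T) d (to (δ k d) lowering T) (x T)
        δ-lowering T unb b e∈T = V.≈ᴹ-trans
          (δ-single F 2ᴱ d T lowering e e∈T λ i i≢e i∈T →
            lowered-zero (remove T i i∈T) (lower? (set T - i))
              λ (_ , _ , e∉T-i) → e∉T-i (x∈p∧x≢y⇒x∈p-y e∈T λ e≡i → i≢e (≡.sym e≡i)))
          (V.≈ᴹ-trans
            (F₁-lowered T-e (lower? (set T - e)) e∉T-e
              -- The case f = e of `local`: T - e is still broken at e.
              (unbroken-⊆ ∈-remove⇒∈ unb , local ℕ.≤-refl b , e∉T-e) (⊆-reflexive T-e∪e≡T))
            (F₁-cell F 2ᴱ d x (insert T-e e∉T-e) T (⊆-reflexive T-e∪e≡T) T-e∪e≡T))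
          where
          module V = F₀ (set T) d
          T-e = remove T e e∈T
          e∉T-e : e ∉ set T - e
          e∉T-e e∈ = ∈-remove⇒≢ {p = set T} e∈ refl
          T-e∪e≡T : (set T - e) ∪ ⁅ e ⁆ ≡ set T
          T-e∪e≡T = insert-remove e∈T

    -- Exactness of the subcomplex in positive degrees: the primitive has to lie in it too, which
    -- later keeps a corrected lift unchanged on NBC.
    Exact : ℕ → Set
    Exact j = ∀ k d (x : ∣ C (suc k) d ∣ᴿ) → Closed (suc k) d x → Vanishes j x →
              ∃[ w ] (Cᴿ._≈ᴹ_ (suc k) d x (to (δ k d) w) × Vanishes j w)

    -- Subtracting δ of the lowering kills x on the sets that contain e, hence (by
    -- vanishes-down) on all sets on which e is the first broken element.
    exact-step : ∀ e → Exact (toℕ e) → Exact (suc (toℕ e))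
    exact-step e exact k d x x-closed x-van =
      let (w′ , u≈δw′ , w′-van) = exact k d u u-closed u-van in
      w Cᵏ.+ᴹ w′ ,
      (begin
        x                                    ≈⟨ CP.//-rightDividesˡ (to (δ k d) w) x ⟨
        u V.+ᴹ to (δ k d) w                  ≈⟨ V.+ᴹ-cong u≈δw′ V.≈ᴹ-refl ⟩
        to (δ k d) w′ V.+ᴹ to (δ k d) w      ≈⟨ V.+ᴹ-comm (to (δ k d) w′) (to (δ k d) w) ⟩
        to (δ k d) w V.+ᴹ to (δ k d) w′      ≈⟨ _⇒_.to-+ (δ k d) w w′ ⟨
        to (δ k d) (w Cᵏ.+ᴹ w′)              ∎) ,
      λ T unb → F₀.≈ᴹ-trans (set T) d
        (F₀.+ᴹ-cong (set T) d (lowering-vanishes e d x T unb) (w′-van T λ f f<e → unb f (ℕ.m<n⇒m<1+n f<e)))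
        (F₀.+ᴹ-identityˡ (set T) d _)
      where
      module V = Cᴿ (suc k) d
      module Cᵏ = Cᴿ k d
      module CP = AbelianGroupProperties V.+ᴹ-abelianGroup
      open SetoidReasoning V.≈ᴹ-setoid
      w = lowering e d x
      u = x V.+ᴹ (V.-ᴹ to (δ k d) w)
      u-closed : Closed (suc k) d u
      u-closed = closed-minus-coboundary k d x w x-closed
      u-value : ∀ T → F₀._≈ᴹ_ (set T) d (x T) (to (δ k d) w T) → F₀._≈ᴹ_ (set T) d (u T) (F₀.0ᴹ (set T) d)
      u-value T = AbelianGroupProperties.x≈y⇒x∙y⁻¹≈ε (F₀.+ᴹ-abelianGroup (set T) d)
      u-van : Vanishes (toℕ e) u
      u-van = vanishes-down e (suc k) d u u-closed
        -- On sets unbroken through e, x vanishes by assumption, and δ w vanishes because w does so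
        -- on all their facets.
        (λ T unb → u-value T (F₀.≈ᴹ-trans (set T) d (x-van T unb)
          (F₀.≈ᴹ-sym (set T) d (δ-zero F 2ᴱ d T w λ i i∈T →
            lowering-vanishes e d x (remove T i i∈T) (unbroken-⊆ ∈-remove⇒∈ unb)))))
        (λ T unb b e∈T → u-value T (F₀.≈ᴹ-sym (set T) d (δ-lowering e d x T unb b e∈T)))

    exact : Exact m
    exact = initial-induction Exact
      -- Every set is unbroken below 0, so x is zero and 0 is a primitive.
      (λ k d x _ van → Cᴿ.0ᴹ k d ,
        (λ T → F₀.≈ᴹ-trans (set T) d (van T λ _ ()) (F₀.≈ᴹ-sym (set T) d (_⇒_.to-0 (δ k d) T))) ,
        λ T _ → F₀.≈ᴹ-refl (set T) d)
      exact-step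

    Exact₀ : ℕ → Set
    Exact₀ j = ∀ d (x : ∣ C 0 d ∣ᴿ) → Closed 0 d x → Vanishes j x → Cᴿ._≈ᴹ_ 0 d x (Cᴿ.0ᴹ 0 d)

    exact₀ : Exact₀ m
    exact₀ = initial-induction Exact₀ (λ d x _ van T → van T λ _ ())
      λ e exact d x closed van → exact d x closed
        -- A set of rank 0 does not contain e, so `vanishes-down` applies to x itself with nothing
        -- subtracted.
        (vanishes-down e 0 d x closed van λ (cell S _ ∣S∣) _ _ e∈S → ⊥-elim-irr (ℕ.0≢1+n (≡.trans (≡.sym ∣S∣) (∣remove∣ e∈S))))

    -- Restriction to the ideal of unbroken sets.

    module Restriction (Q : LowerIdeal m)
                       (unbroken⇒∈ : ∀ {S} → Unbroken m S → LowerIdeal.Member Q S)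
                       (∈⇒unbroken : ∀ {S} → LowerIdeal.Member Q S → Unbroken m S) where

      open LowerIdeal Q
      private
        module Q = Cohomology F Q
        module Qᴿ k d = Rep (Q.C k d)

      inclusion : ∀ {k} → Q.Cell k → Cell k
      inclusion (Q.cell S _ ∣S∣) = cell S tt ∣S∣

      restrict : ∀ k → C k ⇒ᵍ Q.C k
      restrict k d = tuple λ T → proj (λ T′ → F₀ (set T′) d) (inclusion T)

      -- Facets of members of Q are members, so at a member both differentials have the same terms.
      restrict-δ : ∀ k d → (restrict (suc k) d ∘ᴿ δ k d) ≗ (Q.δ k d ∘ᴿ restrict k d)
      restrict-δ k d x T = V.≈ᴹ-trans (δ-sum F 2ᴱ d (inclusion T) x) (V.≈ᴹ-trans
        (FiniteSums.sum-cong-≋ V.+ᴹ-commutativeMonoid (λ i → face-restrict i (i ∈? Q.set T)))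
        (V.≈ᴹ-sym (δ-sum F Q d T (to (restrict k d) x))))
        where
        module V = F₀ (Q.set T) d
        face-restrict : ∀ i (dec : Dec (i ∈ Q.set T)) →
          to (face d (inclusion T) i dec) x V.≈ᴹ to (Q.face d T i dec) (to (restrict k d) x)
        face-restrict i (yes _) = V.≈ᴹ-refl
        face-restrict i (no _)  = V.≈ᴹ-refl

      -- Extension by zero: a section of `restrict` in each degree, but in general not a cochain
      -- map.
      extendAt : ∀ {k d} → ∣ Q.C k d ∣ᴿ → (T : Cell k) → Dec (Unbroken m (set T)) → ∣ F₀ (set T) d ∣ᴿ
      extendAt     y (cell S _ ∣S∣) (yes unb) = y (Q.cell S (unbroken⇒∈ unb) ∣S∣)
      extendAt {d = d} y T          (no _)    = F₀.0ᴹ (set T) d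

      extend : ∀ {k d} → ∣ Q.C k d ∣ᴿ → ∣ C k d ∣ᴿ
      extend y T = extendAt y T (unbroken? m (set T))

      -- A cell holds its membership irrelevantly, so `Unbroken m S` cannot be computed from it. It
      -- is decided instead, and the negative case refuted irrelevantly.
      restrict-extend : ∀ {k d} (y : ∣ Q.C k d ∣ᴿ) → Qᴿ._≈ᴹ_ k d (to (restrict k d) (extend y)) y
      restrict-extend {d = d} y (Q.cell S S∈Q ∣S∣) = at (unbroken? m S)
        where
        at : ∀ dec → F₀._≈ᴹ_ S d (extendAt y (cell S tt ∣S∣) dec) (y (Q.cell S S∈Q ∣S∣))
        at (yes _)   = F₀.≈ᴹ-refl S d
        at (no ¬unb) = ⊥-elim-irr (¬unb (∈⇒unbroken S∈Q))

      vanishes : ∀ {k d} (x : ∣ C k d ∣ᴿ) → Qᴿ._≈ᴹ_ k d (to (restrict k d) x) (Qᴿ.0ᴹ k d) → Vanishes m x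
      vanishes x x≈0 (cell S _ ∣S∣) unb = x≈0 (Q.cell S (unbroken⇒∈ unb) ∣S∣)

      restrict-zero : ∀ {k d} (x : ∣ C k d ∣ᴿ) → Vanishes m x → Qᴿ._≈ᴹ_ k d (to (restrict k d) x) (Qᴿ.0ᴹ k d)
      restrict-zero {d = d} x van (Q.cell S S∈Q ∣S∣) = at (unbroken? m S)
        where
        at : Dec (Unbroken m S) → F₀._≈ᴹ_ S d (x (cell S tt ∣S∣)) (F₀.0ᴹ S d)
        at (yes unb) = van (cell S tt ∣S∣) unb
        at (no ¬unb) = ⊥-elim-irr (¬unb (∈⇒unbroken S∈Q))

      -- For the extension z of y, δ z vanishes on Q and so equals δ w for some w that vanishes on
      -- Q. Then z - w is closed and still restricts to y.
      lift-cocycle : ∀ k d y → Qᴿ._≈ᴹ_ (suc k) d (to (Q.δ k d) y) (Qᴿ.0ᴹ (suc k) d) →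
                     ∃[ x ] (Closed k d x × Qᴿ._≈ᴹ_ k d (to (restrict k d) x) y)
      lift-cocycle k d y δy≈0 =
        let (w , δz≈δw , w-van) = exact k d (to (δ k d) z) (λ T → δ∘δ F 2ᴱ d T z) (vanishes (to (δ k d) z) δz-van) in
        z Cᵏ.+ᴹ (Cᵏ.-ᴹ w) ,
        V.≈ᴹ-trans (_⇒_.to-+ (δ k d) z (Cᵏ.-ᴹ w)) (V.≈ᴹ-trans
          (V.+ᴹ-cong δz≈δw (_⇒_.to-neg (δ k d) w)) (V.-ᴹ‿inverseʳ (to (δ k d) w))) ,
        Y.≈ᴹ-trans (Y.+ᴹ-cong (restrict-extend y) (Y.-ᴹ‿cong (restrict-zero w w-van)))
          (Y.≈ᴹ-trans (Y.+ᴹ-cong Y.≈ᴹ-refl YP.ε⁻¹≈ε) (Y.+ᴹ-identityʳ y))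
        where
        module V = Cᴿ (suc k) d
        module Cᵏ = Cᴿ k d
        module Y = Qᴿ k d
        module YP = AbelianGroupProperties Y.+ᴹ-abelianGroup
        z : ∣ C k d ∣ᴿ
        z = extend y
        δz-van : Qᴿ._≈ᴹ_ (suc k) d (to (restrict (suc k) d) (to (δ k d) z)) (Qᴿ.0ᴹ (suc k) d)
        δz-van = Qᴿ.≈ᴹ-trans (suc k) d (restrict-δ k d z)
          (Qᴿ.≈ᴹ-trans (suc k) d (_⇒_.to-cong (Q.δ k d) (restrict-extend y)) δy≈0)

      -- Subtracting δ of the extension of `a` leaves a cocycle that vanishes on Q, to which
      -- exactness applies.
      lift-coboundary : ∀ k d x a → Closed (suc k) d x →
        Qᴿ._≈ᴹ_ (suc k) d (to (restrict (suc k) d) x) (to (Q.δ k d) a) →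
        ∃[ z ] Cᴿ._≈ᴹ_ (suc k) d x (to (δ k d) z)
      lift-coboundary k d x a x-closed x≈δa =
        let (w , u≈δw , _) = exact k d u u-closed (vanishes u u≈0) in
        w Cᵏ.+ᴹ z ,
        V.≈ᴹ-trans (V.≈ᴹ-sym (VP.//-rightDividesˡ (to (δ k d) z) x))
          (V.≈ᴹ-trans (V.+ᴹ-cong u≈δw V.≈ᴹ-refl) (V.≈ᴹ-sym (_⇒_.to-+ (δ k d) w z)))
        where
        module V = Cᴿ (suc k) d
        module Cᵏ = Cᴿ k d
        module Y = Qᴿ (suc k) d
        module VP = AbelianGroupProperties V.+ᴹ-abelianGroup
        z : ∣ C k d ∣ᴿ
        z = extend a
        u : ∣ C (suc k) d ∣ᴿ
        u = x V.+ᴹ (V.-ᴹ to (δ k d) z)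
        u-closed : Closed (suc k) d u
        u-closed = closed-minus-coboundary k d x z x-closed
        u≈0 : to (restrict (suc k) d) u Y.≈ᴹ Y.0ᴹ
        u≈0 = AbelianGroupProperties.x≈y⇒x∙y⁻¹≈ε Y.+ᴹ-abelianGroup
          (Y.≈ᴹ-trans x≈δa (Y.≈ᴹ-sym (Y.≈ᴹ-trans (restrict-δ k d z)
            (_⇒_.to-cong (Q.δ k d) (restrict-extend a)))))

      restrict-cochains₀ : ∀ d → CochainMap (zeroᴿ {V = trivialZero}) (δ 0 d) (zeroᴿ {V = trivialZero}) (Q.δ 0 d)
      restrict-cochains₀ d = record
        { α = idᴿ ; β = restrict 0 d ; γ = restrict 1 d
        ; square-f = λ _ → _⇒_.to-0 (restrict 0 d) ; square-g = restrict-δ 0 d }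

      restrict-cochains : ∀ k d → CochainMap (δ k d) (δ (suc k) d) (Q.δ k d) (Q.δ (suc k) d)
      restrict-cochains k d = record
        { α = restrict k d ; β = restrict (suc k) d ; γ = restrict (suc (suc k)) d
        ; square-f = restrict-δ k d ; square-g = restrict-δ (suc k) d }

      restrict-H : ∀ k → H k ⇒ᵍ Q.H k
      restrict-H zero    d = induced (restrict-cochains₀ d)
      restrict-H (suc k) d = induced (restrict-cochains k d)

      restrict-H-bijective : ∀ k d → Bijective (restrict-H k d)
      restrict-H-bijective zero    d = induced-bijective (restrict-cochains₀ d)
        (λ x a x-closed x≈0 → a , exact₀ d x x-closed (vanishes x x≈0))
        (lift-cocycle 0 d)
      restrict-H-bijective (suc k) d = induced-bijective (restrict-cochains k d)
        (λ x a x-closed → lift-coboundary k d x a x-closed)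
        (lift-cocycle (suc k) d)

      H≅H : ∀ k → H k ≅ᵍ Q.H k
      H≅H k = bijective⇒≅ᵍ (restrict-H k) (restrict-H-bijective k)

-- Finite search and walks around a cycle.

open import Defs

-- Functions are enumerated through their codes in a finite set. Decoding returns the function only
-- pointwise, so P must respect pointwise equality.
∃-function? : ∀ {k n} {P : (Fin k → Fin n) → Set} → (∀ {f g} → (∀ i → f i ≡ g i) → P f → P g) →
              (∀ f → Dec (P f)) → Dec (∃[ f ] P f)
∃-function? P-ext P? = map′ (λ (i , p) → Fin.finToFun i , p)
  (λ (f , p) → Fin.funToFin f , P-ext (λ i → ≡.sym (Fin.finToFun-funToFin f i)) p)
  (Fin.any? λ i → P? (Fin.finToFun i))

-- Locating a and b among c, d leaves the cases where both equal the same one; there the other of c,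
-- d is located among a, b.
⁅⁆∪⁅⁆-injective : ∀ {n} {a b c d : Fin n} → ⁅ a ⁆ ∪ ⁅ b ⁆ ≡ ⁅ c ⁆ ∪ ⁅ d ⁆ →
                  (a ≡ c × b ≡ d) ⊎ (a ≡ d × b ≡ c)
⁅⁆∪⁅⁆-injective {a = a} {b} {c} {d} eq with member a∈ | member b∈ | member c∈ | member d∈
  where
  member : ∀ {n} {x y z : Fin n} → x ∈ ⁅ y ⁆ ∪ ⁅ z ⁆ → x ≡ y ⊎ x ≡ z
  member {y = y} {z} x∈ = Sum.map (x∈⁅y⁆⇒x≡y y) (x∈⁅y⁆⇒x≡y z) (x∈p∪q⁻ ⁅ y ⁆ ⁅ z ⁆ x∈)
  a∈ : a ∈ ⁅ c ⁆ ∪ ⁅ d ⁆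
  a∈ = ≡.subst (a ∈_) eq (p⊆p∪q ⁅ b ⁆ (x∈⁅x⁆ a))
  b∈ : b ∈ ⁅ c ⁆ ∪ ⁅ d ⁆
  b∈ = ≡.subst (b ∈_) eq (q⊆p∪q ⁅ a ⁆ ⁅ b ⁆ (x∈⁅x⁆ b))
  c∈ : c ∈ ⁅ a ⁆ ∪ ⁅ b ⁆
  c∈ = ≡.subst (c ∈_) (≡.sym eq) (p⊆p∪q ⁅ d ⁆ (x∈⁅x⁆ c))
  d∈ : d ∈ ⁅ a ⁆ ∪ ⁅ b ⁆
  d∈ = ≡.subst (d ∈_) (≡.sym eq) (q⊆p∪q ⁅ c ⁆ ⁅ d ⁆ (x∈⁅x⁆ d))
... | inj₁ a≡c | inj₂ b≡d | _        | _        = inj₁ (a≡c , b≡d)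
... | inj₂ a≡d | inj₁ b≡c | _        | _        = inj₂ (a≡d , b≡c)
... | inj₁ a≡c | inj₁ b≡c | _        | inj₁ d≡a = inj₁ (a≡c , ≡.trans b≡c (≡.trans (≡.sym a≡c) (≡.sym d≡a)))
... | inj₁ a≡c | inj₁ b≡c | _        | inj₂ d≡b = inj₁ (a≡c , ≡.sym d≡b)
... | inj₂ a≡d | inj₂ b≡d | inj₁ c≡a | _        = inj₂ (a≡d , ≡.trans b≡d (≡.trans (≡.sym a≡d) (≡.sym c≡a)))
... | inj₂ a≡d | inj₂ b≡d | inj₂ c≡b | _        = inj₂ (a≡d , ≡.sym c≡b)

toℕ-mod : ∀ t k → toℕ (t mod suc k) ≡ t % suc k
toℕ-mod t k = Fin.toℕ-fromℕ< (m%n<n t (suc k))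

next-mod : ∀ t k → next (t mod suc k) ≡ suc t mod suc k
next-mod t k = Fin.toℕ-injective (begin
  toℕ (suc (toℕ (t mod suc k)) mod suc k)     ≡⟨ toℕ-mod (suc (toℕ (t mod suc k))) k ⟩
  suc (toℕ (t mod suc k)) % suc k             ≡⟨ cong (λ z → suc z % suc k) (toℕ-mod t k) ⟩
  (1 ℕ.+ t % suc k) % suc k                   ≡⟨ %-distribˡ-+ 1 (t % suc k) (suc k) ⟩
  (1 % suc k ℕ.+ t % suc k % suc k) % suc k   ≡⟨ cong (λ z → (1 % suc k ℕ.+ z) % suc k) (m%n%n≡m%n t (suc k)) ⟩
  (1 % suc k ℕ.+ t % suc k) % suc k           ≡⟨ %-distribˡ-+ 1 t (suc k) ⟨
  suc t % suc k                               ≡⟨ toℕ-mod (suc t) k ⟨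
  toℕ (suc t mod suc k)                       ∎)
  where open ≡.≡-Reasoning

toℕ-mod-id : ∀ {k} (i : Fin (suc k)) → toℕ i mod suc k ≡ i
toℕ-mod-id {k} i = Fin.toℕ-injective (≡.trans (toℕ-mod (toℕ i) k) (m<n⇒m%n≡m (Fin.toℕ<n i)))

-- A return after two steps would make the length divide 2.
next∘next≢ : ∀ {k} (i : Fin k) → 3 ℕ.≤ k → next (next i) ≢ i
next∘next≢ {suc k} i 3≤k eq = no-multiple (q / suc k) (ℕ.+-cancelˡ-≡ (toℕ i) _ _ (begin
  toℕ i ℕ.+ 2                                ≡⟨ ℕ.+-comm (toℕ i) 2 ⟩
  q                                          ≡⟨ m≡m%n+[m/n]*n q (suc k) ⟩
  q % suc k ℕ.+ q / suc k ℕ.* suc k          ≡⟨ cong (ℕ._+ q / suc k ℕ.* suc k) (toℕ-mod q k) ⟨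
  toℕ (q mod suc k) ℕ.+ q / suc k ℕ.* suc k  ≡⟨ cong (λ z → toℕ z ℕ.+ q / suc k ℕ.* suc k) (next-mod (suc (toℕ i)) k) ⟨
  toℕ (next (next i)) ℕ.+ q / suc k ℕ.* suc k  ≡⟨ cong (λ z → toℕ z ℕ.+ q / suc k ℕ.* suc k) eq ⟩
  toℕ i ℕ.+ q / suc k ℕ.* suc k              ∎))
  where
  open ≡.≡-Reasoning
  q = suc (suc (toℕ i))
  no-multiple : ∀ a → 2 ≢ a ℕ.* suc k
  no-multiple (suc a) 2≡ = ℕ.<⇒≱ 3≤k (ℕ.≤-trans (ℕ.m≤m+n (suc k) (a ℕ.* suc k)) (ℕ.≤-reflexive (≡.sym 2≡)))

-- Going once around the cycle from next i, the walk stops when it first meets i.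
around : ∀ {k} (_~_ : Fin k → Fin k → Set) → (∀ {a} → a ~ a) → (∀ {a b c} → a ~ b → b ~ c → a ~ c) →
         ∀ i → (∀ j → j ≢ i → j ~ next j) → next i ~ i
around {suc k} _~_ ~-refl ~-trans i step with walk k
  where
  walk : ∀ t → next i ~ i ⊎ next i ~ ((t ℕ.+ suc (toℕ i)) mod suc k)
  walk zero = inj₂ ~-refl
  walk (suc t) with walk t
  ... | inj₁ done = inj₁ done
  ... | inj₂ path with (t ℕ.+ suc (toℕ i)) mod suc k Fin.≟ i
  ... | yes at-i   = inj₁ (≡.subst (next i ~_) at-i path)
  ... | no  not-i  = inj₂ (≡.subst (next i ~_) (next-mod (t ℕ.+ suc (toℕ i)) k) (~-trans path (step _ not-i)))
... | inj₁ done = done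
-- After k steps from next i the position is k + (i + 1), which is i modulo k + 1.
... | inj₂ path = ≡.subst (next i ~_) (≡.trans
  (Fin.toℕ-injective (begin
    toℕ ((k ℕ.+ suc (toℕ i)) mod suc k)   ≡⟨ toℕ-mod (k ℕ.+ suc (toℕ i)) k ⟩
    (k ℕ.+ suc (toℕ i)) % suc k           ≡⟨ cong (_% suc k) (≡.trans (ℕ.+-suc k (toℕ i)) (ℕ.+-comm (suc k) (toℕ i))) ⟩
    (toℕ i ℕ.+ suc k) % suc k             ≡⟨ [m+n]%n≡m%n (toℕ i) (suc k) ⟩
    toℕ i % suc k                         ≡⟨ toℕ-mod (toℕ i) k ⟨
    toℕ (toℕ i mod suc k)                 ∎)) (toℕ-mod-id i)) path
  where open ≡.≡-Reasoning

-- Broken circuits and components of a graph.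

module _ (𝒢 : Graph) where

  open Graph 𝒢

  private
    -- The cycle conditions for given vertex and step functions, written with quantifiers over
    -- finite sets so that they can be checked exhaustively.
    Traces : ∀ {l} → Subset m → (Fin l → Fin n) → (Fin l → Fin m) → Set
    Traces C v s = (∀ i j → v i ≡ v j → i ≡ j) ×
                   (∀ i → edge (s i) ≡ ⁅ v i ⁆ ∪ ⁅ v (next i) ⁆) ×
                   (∀ e → (e ∈ C → ∃[ i ] s i ≡ e) × (∃[ i ] s i ≡ e → e ∈ C))

    traces? : ∀ {l} C (v : Fin l → Fin n) s → Dec (Traces C v s)
    traces? C v s =
      (Fin.all? λ i → Fin.all? λ j → (v i Fin.≟ v j) →-dec (i Fin.≟ j)) ×-dec
      (Fin.all? λ i → ≡-dec Bool._≟_ (edge (s i)) (⁅ v i ⁆ ∪ ⁅ v (next i) ⁆)) ×-dec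
      (Fin.all? λ e → ((e ∈? C) →-dec Fin.any? (λ i → s i Fin.≟ e)) ×-dec
                      (Fin.any? (λ i → s i Fin.≟ e) →-dec (e ∈? C)))

    traces-resp : ∀ {l C} {v v′ : Fin l → Fin n} {s s′} → (∀ i → v i ≡ v′ i) → (∀ i → s i ≡ s′ i) →
                  Traces C v s → Traces C v′ s′
    traces-resp v≡ s≡ (inj , ends , edges) =
      (λ i j eq → inj i j (≡.trans (v≡ i) (≡.trans eq (≡.sym (v≡ j))))) ,
      (λ i → ≡.trans (cong edge (≡.sym (s≡ i)))
               (≡.trans (ends i) (≡.cong₂ (λ a b → ⁅ a ⁆ ∪ ⁅ b ⁆) (v≡ i) (v≡ (next i))))) ,
      λ e → (λ e∈C → let (i , eq) = proj₁ (edges e) e∈C in i , ≡.trans (≡.sym (s≡ i)) eq) ,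
            (λ (i , eq) → proj₂ (edges e) (i , ≡.trans (s≡ i) eq))

    CycleOfLength : Subset m → ℕ → Set
    CycleOfLength C l = 3 ℕ.≤ l × ∃[ v ] ∃[ s ] Traces {l} C v s

    cycleOfLength? : ∀ C l → Dec (CycleOfLength C l)
    cycleOfLength? C l = (3 ℕ.≤? l) ×-dec ∃-function?
      (λ v≡ (s , tr) → s , traces-resp v≡ (λ _ → refl) tr)
      (λ v → ∃-function? (λ s≡ → traces-resp (λ _ → refl) s≡) (traces? C v))

  -- The vertices are distinct, so the length is at most n and the search ranges over `Fin (suc n)`.
  isCycle? : ∀ C → Dec (IsCycle 𝒢 C)
  isCycle? C = map′
    (λ (_ , 3≤l , v , s , inj , ends , edges) → record
      { len≥3 = 3≤l ; vertex = v ; vertex-injective = inj _ _ ; step = s ; step-ends = ends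
      ; edges = λ e → mk⇔ (proj₁ (edges e)) (proj₂ (edges e)) })
    (λ c → let open IsCycle c in
      fromℕ< (s≤s (Fin.injective⇒≤ vertex-injective)) ,
      ≡.subst (CycleOfLength C) (≡.sym (Fin.toℕ-fromℕ< _))
        (len≥3 , vertex , step , (λ _ _ → vertex-injective) , step-ends ,
         λ e → Equivalence.to (edges e) , Equivalence.from (edges e)))
    (Fin.any? {n = suc n} λ l → cycleOfLength? C (toℕ l))

  BrokenAt : Fin m → Subset m → Set
  BrokenAt e S = ∃[ C ] (IsCycle 𝒢 C × e ∈ C × (∀ f → f ∈ C → f Fin.≤ e) × C - e ⊆ S)

  brokenAt? : ∀ e S → Dec (BrokenAt e S)
  brokenAt? e S = anySubset? λ C → isCycle? C ×-dec (e ∈? C) ×-dec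
    (Fin.all? λ f → (f ∈? C) →-dec (f Fin.≤? e)) ×-dec (C - e ⊆? S)

  -- If e were in C - f, maximality of f in C would give e ≤ f ≤ e, so e would be the removed edge
  -- f.
  brokenAt-local : ∀ {e f S} → f Fin.≤ e → BrokenAt f S → BrokenAt f (S - e)
  brokenAt-local {e} {f} f≤e (C , cycle , f∈C , max , C-f⊆S) = C , cycle , f∈C , max , λ g∈ →
    x∈p∧x≢y⇒x∈p-y (C-f⊆S g∈) λ where
      refl → ∈-remove⇒≢ {p = C} g∈ (Fin.≤-antisym (max e (∈-remove⇒∈ g∈)) f≤e)

  brokenAt⇒completes : ∀ {e S} → e ∉ S → BrokenAt e S → CompletesCycle 𝒢 S e
  brokenAt⇒completes {e} {S} e∉S (C , cycle , e∈C , _ , C-e⊆S) = e∉S , C , cycle , e∈C , C⊆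
    where
    C⊆ : C ⊆ S ∪ ⁅ e ⁆
    C⊆ {f} f∈C with f Fin.≟ e
    ... | yes refl = q⊆p∪q S ⁅ e ⁆ (x∈⁅x⁆ e)
    ... | no f≢e   = p⊆p∪q ⁅ e ⁆ (C-e⊆S (x∈p∧x≢y⇒x∈p-y f∈C f≢e))

  adjacent-sym : ∀ {T u v} → Adjacent 𝒢 T u v → Adjacent 𝒢 T v u
  adjacent-sym {u = u} {v} (e , e∈T , ends) = e , e∈T , ≡.trans ends (∪-comm ⁅ u ⁆ ⁅ v ⁆)

  module _ {S : Subset m} {e : Fin m} (completes : CompletesCycle 𝒢 S e) where

    -- The rest of the cycle is a path in S between the ends of e.
    ends-connected : ∀ {u v} → edge e ≡ ⁅ u ⁆ ∪ ⁅ v ⁆ → Connected 𝒢 S u v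
    ends-connected {u} {v} ends = around-cycle completes
      where
      around-cycle : CompletesCycle 𝒢 S e → Connected 𝒢 S u v
      around-cycle (_ , C , cycle , e∈C , C⊆) with IsCycle.edges cycle e
      ... | e∈C⇔ with Equivalence.to e∈C⇔ e∈C
      ... | i , refl = orient (⁅⁆∪⁅⁆-injective (≡.trans (≡.sym ends) (step-ends i)))
        where
        open IsCycle cycle
        -- With distinct vertices, an edge occurring at both i and j would be traversed in opposite
        -- directions, so two steps from i would lead back to i.
        step-≢ : ∀ j → j ≢ i → step j ≢ step i
        step-≢ j j≢i eq with ⁅⁆∪⁅⁆-injective (≡.trans (≡.sym (step-ends j)) (≡.trans (cong edge eq) (step-ends i)))
        ... | inj₁ (vj≡vi , _)      = j≢i (vertex-injective vj≡vi)
        ... | inj₂ (vj≡vi⁺ , vj⁺≡vi) = next∘next≢ i len≥3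
          (≡.trans (cong next (≡.sym (vertex-injective vj≡vi⁺))) (vertex-injective vj⁺≡vi))
        step-connected : ∀ j → j ≢ i → Connected 𝒢 S (vertex j) (vertex (next j))
        step-connected j j≢i with x∈p∪q⁻ S ⁅ step i ⁆ (C⊆ (Equivalence.from (edges (step j)) (j , refl)))
        ... | inj₁ ∈S = (step j , ∈S , step-ends j) ◅ ε
        ... | inj₂ ∈e = contradiction (x∈⁅y⁆⇒x≡y (step i) ∈e) (step-≢ j j≢i)
        path : Connected 𝒢 S (vertex (next i)) (vertex i)
        path = around (λ a b → Connected 𝒢 S (vertex a) (vertex b)) ε _◅◅_ i step-connected
        orient : (u ≡ vertex i × v ≡ vertex (next i)) ⊎ (u ≡ vertex (next i) × v ≡ vertex i) → Connected 𝒢 S u v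
        orient (inj₁ (refl , refl)) = Star.reverse adjacent-sym path
        orient (inj₂ (refl , refl)) = path

    connected-⇔ : ∀ u v → Connected 𝒢 S u v ⇔ Connected 𝒢 (S ∪ ⁅ e ⁆) u v
    connected-⇔ u v = mk⇔ (Star.map λ (f , f∈S , ends) → f , p⊆p∪q ⁅ e ⁆ f∈S , ends) (Star.kleisliStar (λ x → x) detour)
      where
      detour : ∀ {x y} → Adjacent 𝒢 (S ∪ ⁅ e ⁆) x y → Connected 𝒢 S x y
      detour (f , f∈ , ends) with x∈p∪q⁻ S ⁅ e ⁆ f∈
      ... | inj₁ f∈S = (f , f∈S , ends) ◅ ε
      ... | inj₂ f∈e rewrite x∈⁅y⁆⇒x≡y e f∈e = ends-connected ends

    -- A literal equality of lists, as the cycle axiom of the functor requires. Blocks are read off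
    -- from the booleans of `connected?`, which agree once the relations are equivalent.
    same-components : components 𝒢 S ≡ components 𝒢 (S ∪ ⁅ e ⁆)
    same-components = cong (deduplicate (≡-dec Bool._≟_)) (List.map-cong
      (λ u → tabulate-cong λ v → does-⇔ (connected-⇔ u v) (connected? 𝒢 S u v) (connected? 𝒢 (S ∪ ⁅ e ⁆) u v))
      (allFin n))

  𝓜-identity-bijective : ∀ {π π′ : Blocks n} (eq : π ≡ π′) d → Bijective ℂ (𝓜-identity eq d)
  𝓜-identity-bijective {π} refl d = (λ x≈0 → x≈0) , λ y → y , Rep.≈ᴹ-refl (𝓜 π d)

  module _ (Fᶜˢ : ChromaticSymmetricFunctor 𝒢) where

    open ChromaticSymmetricFunctor Fᶜˢ using (d; cycle; functor)

    cycle-bijective : ∀ {e S} → e ∉ S → BrokenAt e S → ∀ k → Bijective ℂ (d {S} {S ∪ ⁅ e ⁆} (p⊆p∪q ⁅ e ⁆) k)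
    cycle-bijective {e} {S} e∉S b k =
      let completes = brokenAt⇒completes e∉S b
          same      = same-components completes
      in bijective-≗ ℂ {f = d _ k} {g = 𝓜-identity same k} (λ x → cycle S e completes same k x) (𝓜-identity-bijective same k)

    matching : Matching ℂ functor
    matching = record
      { Broken    = BrokenAt
      ; broken?   = brokenAt?
      ; monotone  = λ S⊆T (C , cycle , e∈C , max , C-e⊆S) → C , cycle , e∈C , max , ⊆-trans C-e⊆S S⊆T
      ; local     = brokenAt-local
      ; bijective = cycle-bijective }

    unbroken⇒nbc : ∀ {S} → Matching.Unbroken matching m S → NBC 𝒢 S
    unbroken⇒nbc {S} unb B (C , e , cycle , e∈C , max , B≡C-e) B⊆S =
      unb e (Fin.toℕ<n e) (C , cycle , e∈C , max , ≡.subst (_⊆ S) B≡C-e B⊆S)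

    nbc⇒unbroken : ∀ {S} → NBC 𝒢 S → Matching.Unbroken matching m S
    nbc⇒unbroken nbc e _ (C , cycle , e∈C , max , C-e⊆S) =
      nbc (C - e) (C , e , cycle , e∈C , max , refl) C-e⊆S

    open Restriction ℂ functor matching (NBC-ideal 𝒢) unbroken⇒nbc nbc⇒unbroken public
      using () renaming (H≅H to H≅H-NBC)

theorem6p5 : (𝒢 : Graph) (Fᶜˢ : ChromaticSymmetricFunctor 𝒢) (k : ℕ) →
    let F = ChromaticSymmetricFunctor.functor Fᶜˢ in
    Cohomology.H F 2ᴱ k ≅ᵍ Cohomology.H F (NBC-ideal 𝒢) k
theorem6p5 = H≅H-NBC
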